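{- Let $\mathcal{A}$ be a balanced extensional $\mathbf{BC^{\pm}I}$-algebra (with structure elements $\mathbf{B},\mathbf{C}^+,\mathbf{C}^-,\mathbf{I},\boldsymbol{\theta}^+,\boldsymbol{\theta}^-$). Then there exists an element $\mathbf{Tr}\in\mathcal{A}$ making $\mathcal{A}$ a traced extensional $\mathbf{BC^{\pm}I}$-algebra if and only if there exist elements $\boldsymbol{\alpha},\boldsymbol{\beta}\in\mathcal{A}$ making $\mathcal{A}$ a ribbon extensional $\mathbf{BC^{\pm}I}$-algebra.
   Context: An applicative structure is a set $\mathcal{A}$ with a binary operation $(a,b)\mapsto a\,b$; application associates to the left ($a\,b\,c=(a\,b)\,c$). Given elements $\mathbf{B},\mathbf{I}$, write $a\circ b:=\mathbf{B}\,a\,b$, $a^0:=\mathbf{I}$, $a^{n+1}:=a\circ a^n$. An extensional $\mathbf{BC^{\pm}I}$-algebra is an applicative structure with elements $\mathbf{B},\mathbf{C}^+,\mathbf{C}^-,\mathbf{I}$ such that for all $a,b,c$: $\mathbf{B}\,a\,b\,c=a\,(b\,c)$; $\mathbf{C}^\star\,a\,b\,c=a\,c\,b$; $\mathbf{I}\,a=a$; $\mathbf{C}^+\,a\,b=\mathbf{C}^-\,a\,b$; $\mathbf{B}\,\mathbf{I}=\mathbf{I}$; $\mathbf{C}^\star\,\mathbf{B}\,\mathbf{I}=\mathbf{B}\,\mathbf{I}$; $(\mathbf{C}^\star\,\mathbf{B}\,\mathbf{B})\circ(\mathbf{B}\circ\mathbf{B})=(\mathbf{B}\,\mathbf{B})\circ\mathbf{B}$;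 $\mathbf{C}^\pm\circ\mathbf{C}^\mp=\mathbf{B}\,(\mathbf{B}\,\mathbf{I})$; $(\mathbf{C}^\star\,\mathbf{B}\,\mathbf{C}^\pm)\circ(\mathbf{B}\circ\mathbf{B})=(\mathbf{B}\,\mathbf{C}^\pm)\circ(\mathbf{B}\circ\mathbf{B})$; $(\mathbf{B}\,\mathbf{C}^\pm)\circ(\mathbf{C}^\pm\circ(\mathbf{B}\,\mathbf{C}^\pm))=\mathbf{C}^\pm\circ((\mathbf{B}\,\mathbf{C}^\pm)\circ\mathbf{C}^\pm)$; $(\mathbf{B}\,\mathbf{B})\circ\mathbf{C}^\pm=\mathbf{C}^\pm\circ((\mathbf{B}\,\mathbf{C}^\pm)\circ\mathbf{B})$. Here each occurrence of $\star$ ranges independently over $\{+,-\}$, and in an equation with $\pm$/$\mp$ the signs are linked, the equation being required for both choices. It is balanced if moreover there are elements $\boldsymbol{\theta}^+,\boldsymbol{\theta}^-$ with, for all $a$: $(\mathbf{B}\,\boldsymbol{\theta}^\pm)\circ\mathbf{B}=(\mathbf{C}^\star\,\mathbf{B}\,\boldsymbol{\theta}^\pm)\circ\mathbf{B}$; $\boldsymbol{\theta}^\pm\circ\boldsymbol{\theta}^\mp=\mathbf{B}\,\mathbf{I}$; $\mathbf{C}^\star\,\boldsymbol{\theta}^\star\,a=\mathbf{C}^\star\,\mathbf{I}\,a$; $\mathbf{B}\circ\boldsymbol{\theta}^\pm=\boldsymbol{\theta}^\pm\circ(\mathbf{C}^\pm\circ(\boldsymbol{\theta}^\pm\circ(\mathbf{C}^\pm\circ\mathbf{B})))$.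 A balanced extensional $\mathbf{BC^{\pm}I}$-algebra is traced if it has an element $\mathbf{Tr}$ with: $(\mathbf{C}^\star\,\mathbf{B}\,\mathbf{Tr})\circ\mathbf{B}=(\mathbf{B}\,\mathbf{Tr})\circ\mathbf{B}^2$; $(\mathbf{B}\,\mathbf{Tr})\circ((\mathbf{C}^\star\,\mathbf{B}\,\mathbf{B})\circ\mathbf{B})=\mathbf{B}\circ\mathbf{Tr}$; $\mathbf{Tr}\,\mathbf{C}^\pm=\boldsymbol{\theta}^\pm$; $\mathbf{Tr}^2\circ((\mathbf{C}^\star\,\mathbf{B}\,\mathbf{C}^-)\circ(\mathbf{B}\,\mathbf{C}^+))=\mathbf{Tr}^2$. Write $a^\bullet:=\mathbf{C}^+\,\mathbf{I}\,a$. A duality is a pair $\boldsymbol{\alpha},\boldsymbol{\beta}$ with $\boldsymbol{\alpha}^\bullet\circ\mathbf{B}=(\mathbf{B}\,\boldsymbol{\alpha})\circ\mathbf{B}^2$, $\boldsymbol{\beta}^\bullet\circ\mathbf{B}^3=\mathbf{B}\,\boldsymbol{\beta}$, $\boldsymbol{\alpha}\circ(\mathbf{B}\,\boldsymbol{\beta})=\mathbf{B}\,\mathbf{I}$, $(\mathbf{B}\,\boldsymbol{\alpha})\circ\boldsymbol{\beta}=\mathbf{B}\,\mathbf{I}$. A balanced extensional $\mathbf{BC^{\pm}I}$-algebra is ribbon if it has a duality $\boldsymbol{\alpha},\boldsymbol{\beta}$ with moreover $\boldsymbol{\alpha}\circ\boldsymbol{\theta}^\pm=\boldsymbol{\alpha}\circ(\mathbf{B}\,\boldsymbol{\theta}^\pm)$.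 -}

module Defs where

open import Level using (Level; suc; _⊔_)
open import Data.Nat using (ℕ; zero; suc)
open import Data.Product using (Σ; _×_; _,_)
open import Relation.Binary.PropositionalEquality using (_≡_)

data Sign : Set where
  pos neg : Sign

flip : Sign → Sign
flip pos = neg
flip neg = pos

record BCI-data (ℓ : Level) : Set (Level.suc ℓ) where
  infixl 9 _·_
  field
    Carrier : Set ℓ
    _·_ : Carrier → Carrier → Carrier
    B I : Carrier
    C : Sign → Carrier

  infixr 8 _∘_
  _∘_ : Carrier → Carrier → Carrier
  a ∘ b = B · a · b

  _^_ : Carrier → ℕ → Carrier
  a ^ zero = I
  a ^ suc n = a ∘ (a ^ n)

  _• : Carrier → Carrier
  a • = C pos · I · a

  -- extensional BC±I-algebra axioms
  -- (⋆ ranges independently over signs; ± / ∓ linked: s and flip s)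
  IsExtensional : Set ℓ
  IsExtensional =
      (∀ a b c → B · a · b · c ≡ a · (b · c))
    × (∀ s a b c → C s · a · b · c ≡ a · c · b)
    × (∀ a → I · a ≡ a)
    × (∀ a b → C pos · a · b ≡ C neg · a · b)
    × (B · I ≡ I)
    × (∀ s → C s · B · I ≡ B · I)
    × (∀ s → (C s · B · B) ∘ (B ∘ B) ≡ (B · B) ∘ B)
    × (∀ s → C s ∘ C (flip s) ≡ B · (B · I))
    × (∀ t s → (C t · B · C s) ∘ (B ∘ B) ≡ (B · C s) ∘ (B ∘ B))
    × (∀ s → (B · C s) ∘ (C s ∘ (B · C s)) ≡ C s ∘ ((B · C s) ∘ C s))
    × (∀ s → (B · B) ∘ C s ≡ C s ∘ ((B · C s) ∘ B))

  IsBalancing : (Sign → Carrier) → Set ℓ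
  IsBalancing θ =
      (∀ t s → (B · θ s) ∘ B ≡ (C t · B · θ s) ∘ B)
    × (∀ s → θ s ∘ θ (flip s) ≡ B · I)
    × (∀ t s u a → C t · θ s · a ≡ C u · I · a)
    × (∀ s → B ∘ θ s ≡ θ s ∘ (C s ∘ (θ s ∘ (C s ∘ B))))

  IsTrace : (Sign → Carrier) → Carrier → Set ℓ
  IsTrace θ Tr =
      (∀ t → (C t · B · Tr) ∘ B ≡ (B · Tr) ∘ (B ^ 2))
    × (∀ t → (B · Tr) ∘ ((C t · B · B) ∘ B) ≡ B ∘ Tr)
    × (∀ s → Tr · C s ≡ θ s)
    × (∀ t → (Tr ^ 2) ∘ ((C t · B · C neg) ∘ (B · C pos)) ≡ Tr ^ 2)

  IsDuality : Carrier → Carrier → Set ℓ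
  IsDuality α β =
      ((α •) ∘ B ≡ (B · α) ∘ (B ^ 2))
    × ((β •) ∘ (B ^ 3) ≡ B · β)
    × (α ∘ (B · β) ≡ B · I)
    × ((B · α) ∘ β ≡ B · I)

  IsRibbon : (Sign → Carrier) → Carrier → Carrier → Set ℓ
  IsRibbon θ α β =
      IsDuality α β
    × (∀ s → α ∘ θ s ≡ α ∘ (B · θ s))

{-# OPTIONS --safe #-}
-- (A, ∘, I) is a monoid with endomorphism ↑ a = B · a. An element a acts as a diagram in
-- continuation-passing style, ↑ adds a strand in front, and the axioms say that B : 2 → 1,
-- C± : 2 → 2, θ± : 1 → 1 and a • : 0 → 1 are arrows of a balanced braided category generated
-- by one strand, in which every arrow m → n is natural for the braiding. Application is
-- recovered from (a · b) • = b • ∘ a • ∘ B, so everything becomes a diagram calculation.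
--
-- A trace gives a self-duality: Tr : 1 → 2 is an arrow with Tr ∘ ↑ f ∘ B = ↑ (Tr · f), the
-- counit β pairs x and y by the trace of the composite x ∘ y, and the unit α is obtained by
-- currying Tr, so that α ∘ ↑ B = Tr. Exchanging two nested traces makes β cyclic, for either
-- sign of the braiding, and comparing the two signs yields the ribbon condition.
-- Conversely, with γ = C± ∘ θ± ∘ β one puts Tr · f = α ∘ ↑ f ∘ γ; naturality of the twist
-- along β makes γ independent of the sign, which yields yanking for both signs.
module Submission where

open import Defs
open import Level using (Level)
open import Data.List using (List; []; _∷_; _++_; map; replicate)
open import Data.Nat using (ℕ; zero; suc)
open import Data.Product using (Σ; _×_; _,_; proj₁; proj₂)
open import Data.Unit.Polymorphic using (⊤)
open import Function.Bundles using (_⇔_; mk⇔)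
open import Relation.Binary.Bundles using (Setoid)
open import Relation.Binary.PropositionalEquality
  using (_≡_; refl; sym; trans; cong; cong₂; module ≡-Reasoning)
import Relation.Binary.Reasoning.Setoid as SetoidReasoning

-- The monoid of an extensional algebra.

module Extensional {ℓ : Level} (𝒜 : BCI-data ℓ) (ext : BCI-data.IsExtensional 𝒜) where

  open BCI-data 𝒜 public

  infix 20 ↑_
  ↑_ : Carrier → Carrier
  ↑ a = B · a

  B-app : ∀ a b c → (a ∘ b) · c ≡ a · (b · c)
  B-app = let p , _ = ext in p

  C-app : ∀ s a b c → C s · a · b · c ≡ a · c · b
  C-app = let _ , p , _ = ext in p

  I-app : ∀ a → I · a ≡ a
  I-app = let _ , _ , p , _ = ext in p

  ↑-I : ↑ I ≡ I
  ↑-I = let _ , _ , _ , _ , p , _ = ext in p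

  module _ where
    open ≡-Reasoning

    I•-swap : ∀ s a → C s · I · a ≡ a •
    I•-swap pos a = refl
    I•-swap neg a = let _ , _ , _ , p , _ = ext in sym (p I a)

    ∘-identityˡ : ∀ a → I ∘ a ≡ a
    ∘-identityˡ a = trans (cong (_· a) ↑-I) (I-app a)

    CBI : ∀ s → C s · B · I ≡ I
    CBI s = let _ , _ , _ , _ , _ , p , _ = ext in trans (p s) ↑-I

    ∘-identityʳ : ∀ a → a ∘ I ≡ a
    ∘-identityʳ a = begin
      a ∘ I            ≡⟨ C-app pos B I a ⟨
      C pos · B · I · a ≡⟨ cong (_· a) (CBI pos) ⟩
      I · a            ≡⟨ I-app a ⟩
      a                ∎

    -- The axiom on `B ∘ B`, evaluated at `a`. Evaluated once more at `b` it makes `↑`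
    -- multiplicative, and from that associativity of `∘` follows.
    B-natural : ∀ a → ↑ ↑ a ∘ B ≡ B ∘ ↑ a
    B-natural a = begin
      ↑ ↑ a ∘ B                       ≡⟨ C-app pos B B (↑ ↑ a) ⟨
      C pos · B · B · ↑ ↑ a           ≡⟨ cong (C pos · B · B ·_) (B-app B B a) ⟨
      C pos · B · B · ((B ∘ B) · a)   ≡⟨ B-app _ _ a ⟨
      ((C pos · B · B) ∘ (B ∘ B)) · a ≡⟨ cong (_· a) (B-arrow pos) ⟩
      (↑ B ∘ B) · a                   ≡⟨ B-app _ _ a ⟩
      B ∘ ↑ a                         ∎
      where
      B-arrow : ∀ s → (C s · B · B) ∘ (B ∘ B) ≡ ↑ B ∘ B
      B-arrow = let _ , _ , _ , _ , _ , _ , p , _ = ext in p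

    ↑-∘ : ∀ a b → ↑ (a ∘ b) ≡ ↑ a ∘ ↑ b
    ↑-∘ a b = begin
      ↑ (a ∘ b)           ≡⟨ B-app B (↑ a) b ⟨
      (B ∘ ↑ a) · b       ≡⟨ cong (_· b) (B-natural a) ⟨
      (↑ ↑ a ∘ B) · b     ≡⟨ B-app _ _ b ⟩
      ↑ a ∘ ↑ b           ∎

    ∘-assoc : ∀ a b c → (a ∘ b) ∘ c ≡ a ∘ (b ∘ c)
    ∘-assoc a b c = trans (cong (_· c) (↑-∘ a b)) (B-app _ _ c)

  -- Words and rewriting inside them.

  -- A word a₁ ∷ … ∷ aₙ ∷ [] stands for a₁ ∘ … ∘ aₙ.
  ⟦_⟧ : List Carrier → Carrier
  ⟦ [] ⟧        = I
  ⟦ a ∷ [] ⟧    = a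
  ⟦ a ∷ b ∷ w ⟧ = a ∘ ⟦ b ∷ w ⟧

  infix 4 _≈_
  -- A record rather than a bare equation: `⟦_⟧` cannot be inverted by unification, whereas the
  -- parameters `u` and `v` can be read off the type.
  record _≈_ (u v : List Carrier) : Set ℓ where
    constructor by
    field equal : ⟦ u ⟧ ≡ ⟦ v ⟧
  open _≈_ public

  words : Setoid ℓ ℓ
  words = record
    { Carrier       = List Carrier
    ; _≈_           = _≈_
    ; isEquivalence = record
      { refl  = by refl
      ; sym   = λ p → by (sym (equal p))
      ; trans = λ p q → by (trans (equal p) (equal q))
      }
    }

  open Setoid words public using () renaming (sym to ≈-sym; trans to ≈-trans; refl to ≈-refl)

  ⟦∷⟧ : ∀ a w → ⟦ a ∷ w ⟧ ≡ a ∘ ⟦ w ⟧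
  ⟦∷⟧ a []      = sym (∘-identityʳ a)
  ⟦∷⟧ a (b ∷ w) = refl

  ⟦++⟧ : ∀ u v → ⟦ u ++ v ⟧ ≡ ⟦ u ⟧ ∘ ⟦ v ⟧
  ⟦++⟧ []      v = sym (∘-identityˡ _)
  ⟦++⟧ (a ∷ u) v = begin
    ⟦ a ∷ (u ++ v) ⟧    ≡⟨ ⟦∷⟧ a (u ++ v) ⟩
    a ∘ ⟦ u ++ v ⟧      ≡⟨ cong (a ∘_) (⟦++⟧ u v) ⟩
    a ∘ (⟦ u ⟧ ∘ ⟦ v ⟧) ≡⟨ ∘-assoc _ _ _ ⟨
    (a ∘ ⟦ u ⟧) ∘ ⟦ v ⟧ ≡⟨ cong (_∘ ⟦ v ⟧) (⟦∷⟧ a u) ⟨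
    ⟦ a ∷ u ⟧ ∘ ⟦ v ⟧   ∎
    where open ≡-Reasoning

  ⟦map-↑⟧ : ∀ u → ⟦ map ↑_ u ⟧ ≡ ↑ ⟦ u ⟧
  ⟦map-↑⟧ []      = sym ↑-I
  ⟦map-↑⟧ (a ∷ u) = begin
    ⟦ ↑ a ∷ map ↑_ u ⟧ ≡⟨ ⟦∷⟧ _ (map ↑_ u) ⟩
    ↑ a ∘ ⟦ map ↑_ u ⟧ ≡⟨ cong (↑ a ∘_) (⟦map-↑⟧ u) ⟩
    ↑ a ∘ ↑ ⟦ u ⟧      ≡⟨ ↑-∘ _ _ ⟨
    ↑ (a ∘ ⟦ u ⟧)      ≡⟨ cong ↑_ (⟦∷⟧ a u) ⟨
    ↑ ⟦ a ∷ u ⟧        ∎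
    where open ≡-Reasoning

  -- Prefixes are tuples rather than lists, so that η lets Agda infer them from their length.
  Prefix : ℕ → Set ℓ
  Prefix zero    = ⊤
  Prefix (suc n) = Carrier × Prefix n

  prepend : ∀ n → Prefix n → List Carrier → List Carrier
  prepend zero    p w = w
  prepend (suc n) p w = proj₁ p ∷ prepend n (proj₂ p) w

  under : ∀ n {p u v} → u ≈ v → prepend n p u ≈ prepend n p v
  under zero                    e = e
  under (suc n) {a , p} {u} {v} e = by (begin
    ⟦ a ∷ prepend n p u ⟧ ≡⟨ ⟦∷⟧ a (prepend n p u) ⟩
    a ∘ ⟦ prepend n p u ⟧ ≡⟨ cong (a ∘_) (equal (under n {p} e)) ⟩
    a ∘ ⟦ prepend n p v ⟧ ≡⟨ ⟦∷⟧ a (prepend n p v) ⟨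
    ⟦ a ∷ prepend n p v ⟧ ∎)
    where open ≡-Reasoning

  ++-congʳ : ∀ {u v} w → u ≈ v → u ++ w ≈ v ++ w
  ++-congʳ {u} {v} w e = by (begin
    ⟦ u ++ w ⟧    ≡⟨ ⟦++⟧ u w ⟩
    ⟦ u ⟧ ∘ ⟦ w ⟧ ≡⟨ cong (_∘ ⟦ w ⟧) (equal e) ⟩
    ⟦ v ⟧ ∘ ⟦ w ⟧ ≡⟨ ⟦++⟧ v w ⟨
    ⟦ v ++ w ⟧    ∎)
    where open ≡-Reasoning

  ++-congˡ : ∀ {u v} w → u ≈ v → w ++ u ≈ w ++ v
  ++-congˡ []      e = e
  ++-congˡ (a ∷ w) e = under 1 (++-congˡ w e)

  -- The usual rewriting step: skip `n` letters, replace a factor, keep the rest. `under n` instead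
  -- replaces everything after the skipped letters.
  at : ∀ n {p u v w} → u ≈ v → prepend n p (u ++ w) ≈ prepend n p (v ++ w)
  at n {w = w} e = under n (++-congʳ w e)

  shift : ∀ {u v} → u ≈ v → map ↑_ u ≈ map ↑_ v
  shift {u} {v} e = by (trans (⟦map-↑⟧ u) (trans (cong ↑_ (equal e)) (sym (⟦map-↑⟧ v))))

  fuse : ∀ u → ⟦ u ⟧ ∷ [] ≈ u
  fuse u = by refl

  letter : ∀ {a b} → a ≡ b → a ∷ [] ≈ b ∷ []
  letter e = by e

  ↑-split : ∀ a b → ↑ (a ∘ b) ∷ [] ≈ ↑ a ∷ ↑ b ∷ []
  ↑-split a b = by (↑-∘ a b)

  module ≈-Reasoning = SetoidReasoning words

  -- Braid relations.

  module _ where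
    open ≈-Reasoning

    C-inverse : ∀ s → C s ∷ C (flip s) ∷ [] ≈ []
    C-inverse s = by (let _ , _ , _ , _ , _ , _ , _ , p , _ = ext in
      trans (p s) (trans (cong ↑_ ↑-I) ↑-I))

    C-inverse′ : ∀ s → C (flip s) ∷ C s ∷ [] ≈ []
    C-inverse′ pos = C-inverse neg
    C-inverse′ neg = C-inverse pos

    C-cancelˡ : ∀ s {u v} → C s ∷ u ≈ C s ∷ v → u ≈ v
    C-cancelˡ s {u} {v} e = begin
      u                       ≈⟨ at 0 (C-inverse′ s) ⟨
      C (flip s) ∷ C s ∷ u    ≈⟨ under 1 e ⟩
      C (flip s) ∷ C s ∷ v    ≈⟨ at 0 (C-inverse′ s) ⟩
      v                       ∎

    yang-baxter : ∀ s → ↑ C s ∷ C s ∷ ↑ C s ∷ [] ≈ C s ∷ ↑ C s ∷ C s ∷ []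
    yang-baxter s = by (let _ , _ , _ , _ , _ , _ , _ , _ , _ , p , _ = ext in p s)

    yang-baxter′ : ∀ s → C s ∷ ↑ C s ∷ C (flip s) ∷ [] ≈ ↑ C (flip s) ∷ C s ∷ ↑ C s ∷ []
    yang-baxter′ s = begin
      C s ∷ ↑ C s ∷ C (flip s) ∷ []                               ≈⟨ at 0 (shift (C-inverse′ s)) ⟨
      ↑ C (flip s) ∷ ↑ C s ∷ C s ∷ ↑ C s ∷ C (flip s) ∷ []        ≈⟨ at 1 (yang-baxter s) ⟩
      ↑ C (flip s) ∷ C s ∷ ↑ C s ∷ C s ∷ C (flip s) ∷ []          ≈⟨ under 3 (C-inverse s) ⟩
      ↑ C (flip s) ∷ C s ∷ ↑ C s ∷ []                             ∎

    hexagon : ∀ s → ↑ B ∷ C s ∷ [] ≈ C s ∷ ↑ C s ∷ B ∷ []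
    hexagon s = by (let _ , _ , _ , _ , _ , _ , _ , _ , _ , _ , p = ext in p s)

    -- The strand passes the node `B` from the other side. This is `hexagon` for the opposite sign,
    -- with its two crossings inverted and carried across.
    hexagon′ : ∀ s → B ∷ C s ∷ [] ≈ ↑ C s ∷ C s ∷ ↑ B ∷ []
    hexagon′ s = begin
      B ∷ C s ∷ []                                            ≈⟨ at 0 (shift (C-inverse s)) ⟨
      ↑ C s ∷ ↑ C (flip s) ∷ B ∷ C s ∷ []                     ≈⟨ at 1 (C-inverse s) ⟨
      ↑ C s ∷ C s ∷ C (flip s) ∷ ↑ C (flip s) ∷ B ∷ C s ∷ []  ≈⟨ at 2 (hexagon (flip s)) ⟨
      ↑ C s ∷ C s ∷ ↑ B ∷ C (flip s) ∷ C s ∷ []               ≈⟨ at 3 (C-inverse′ s) ⟩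
      ↑ C s ∷ C s ∷ ↑ B ∷ []                                  ∎

    hexagon″ : ∀ s → C s ∷ ↑ B ∷ [] ≈ ↑ C (flip s) ∷ B ∷ C s ∷ []
    hexagon″ s = begin
      C s ∷ ↑ B ∷ []                            ≈⟨ at 0 (shift (C-inverse′ s)) ⟨
      ↑ C (flip s) ∷ ↑ C s ∷ C s ∷ ↑ B ∷ []     ≈⟨ at 1 (hexagon′ s) ⟨
      ↑ C (flip s) ∷ B ∷ C s ∷ []               ∎

  -- Application in terms of composition; naturality of crossings and points.

  module _ where
    open ≡-Reasoning

    -- Evaluating the hexagon at `c` and `b` brings `↑` inside `C s · c · b`. The case where `c` is
    -- `I` reduces `C s` to composition with `b •`, which no longer depends on the sign.
    C-decompose : ∀ s a b → C s · a · b ≡ b • ∘ a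
    C-decompose s a b = begin
      C s · a · b                     ≡⟨ cong (λ x → C s · x · b) (∘-identityˡ a) ⟨
      C s · (I ∘ a) · b               ≡⟨ cong (_· b) (B-app _ _ a) ⟨
      (C s ∘ ↑ I) · a · b             ≡⟨ C-app s (C s ∘ ↑ I) b a ⟨
      C s · (C s ∘ ↑ I) · b · a       ≡⟨ cong (_· a) (↑-C I) ⟨
      (C s · I · b) ∘ a               ≡⟨ cong (_∘ a) (I•-swap s b) ⟩
      b • ∘ a                         ∎
      where
      ↑-C : ∀ c → ↑ (C s · c · b) ≡ C s · (C s ∘ ↑ c) · b
      ↑-C c = begin
        ↑ (C s · c · b)                ≡⟨ B-app _ _ b ⟨
        (B ∘ (C s · c)) · b            ≡⟨ cong (_· b) (B-app (↑ B) (C s) c) ⟨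
        (↑ B ∘ C s) · c · b            ≡⟨ cong (λ x → x · c · b) (equal (hexagon s)) ⟩
        (C s ∘ (↑ C s ∘ B)) · c · b    ≡⟨ cong (_· b) (B-app _ _ c) ⟩
        C s · ((↑ C s ∘ B) · c) · b    ≡⟨ cong (λ x → C s · x · b) (B-app _ _ c) ⟩
        C s · (C s ∘ ↑ c) · b          ∎

    -- The content is `hexagon′` evaluated at `I`; the two remaining flips are removed by
    -- `C-decompose`.
    app-• : ∀ a b → (a · b) • ∷ [] ≈ b • ∷ a • ∷ B ∷ []
    app-• a b = by (begin
      C pos · I · (a · b)                      ≡⟨ B-app _ _ b ⟨
      ↑ (C pos · I) · a · b                    ≡⟨ cong (λ x → x · a · b) ↑-CI ⟩
      (C pos ∘ (C pos · B)) · a · b            ≡⟨ cong (_· b) (B-app _ _ a) ⟩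
      C pos · (C pos · B · a) · b              ≡⟨ C-decompose pos _ b ⟩
      b • ∘ (C pos · B · a)                    ≡⟨ cong (b • ∘_) (C-decompose pos B a) ⟩
      b • ∘ (a • ∘ B)                          ∎)
      where
      ↑-CI : ↑ (C pos · I) ≡ C pos ∘ (C pos · B)
      ↑-CI = begin
        ↑ (C pos · I)                          ≡⟨ B-app _ _ I ⟨
        (B ∘ C pos) · I                        ≡⟨ cong (_· I) (equal (hexagon′ pos)) ⟩
        (↑ C pos ∘ (C pos ∘ ↑ B)) · I          ≡⟨ B-app _ _ I ⟩
        C pos ∘ ((C pos ∘ ↑ B) · I)            ≡⟨ cong (C pos ∘_) (B-app _ _ I) ⟩
        C pos ∘ (C pos · (B ∘ I))              ≡⟨ cong (λ x → C pos ∘ (C pos · x)) (∘-identityʳ B) ⟩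
        C pos ∘ (C pos · B)                    ∎

    -- The hexagon evaluated at `I` and `a`. Both signs are available because a point cannot tell
    -- passing over from passing under.
    ↑-• : ∀ s a → ↑ (a •) ∷ [] ≈ a • ∷ C s ∷ []
    ↑-• s a = by (begin
      ↑ (a •)                                  ≡⟨ cong ↑_ (I•-swap s a) ⟨
      ↑ (C s · I · a)                          ≡⟨ B-app _ _ a ⟨
      (B ∘ (C s · I)) · a                      ≡⟨ cong (_· a) (B-app (↑ B) (C s) I) ⟨
      (↑ B ∘ C s) · I · a                      ≡⟨ cong (λ x → x · I · a) (equal (hexagon s)) ⟩
      (C s ∘ (↑ C s ∘ B)) · I · a              ≡⟨ cong (_· a) (B-app _ _ I) ⟩
      C s · ((↑ C s ∘ B) · I) · a              ≡⟨ cong (λ x → C s · x · a) (B-app _ _ I) ⟩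
      C s · (C s ∘ ↑ I) · a                    ≡⟨ cong (λ x → C s · (C s ∘ x) · a) ↑-I ⟩
      C s · (C s ∘ I) · a                      ≡⟨ cong (λ x → C s · x · a) (∘-identityʳ _) ⟩
      C s · C s · a                            ≡⟨ C-decompose s _ a ⟩
      a • ∘ C s                                ∎)

    C-natural : ∀ s c → C s ∷ ↑ ↑ c ∷ [] ≈ ↑ ↑ c ∷ C s ∷ []
    C-natural s c = by (begin
      C s ∘ ↑ ↑ c                              ≡⟨ cong (C s ∘_) (B-app B B c) ⟨
      C s ∘ ((B ∘ B) · c)                      ≡⟨ B-app _ _ c ⟨
      (↑ C s ∘ (B ∘ B)) · c                    ≡⟨ cong (_· c) C-arrow ⟨
      ((C pos · B · C s) ∘ (B ∘ B)) · c        ≡⟨ B-app _ _ c ⟩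
      C pos · B · C s · ((B ∘ B) · c)          ≡⟨ C-app pos _ _ _ ⟩
      (B · ((B ∘ B) · c)) · C s                ≡⟨ cong (_∘ C s) (B-app B B c) ⟩
      ↑ ↑ c ∘ C s                              ∎)
      where
      C-arrow : (C pos · B · C s) ∘ (B ∘ B) ≡ ↑ C s ∘ (B ∘ B)
      C-arrow = let _ , _ , _ , _ , _ , _ , _ , _ , p , _ = ext in p pos s

    •-natural : ∀ a c → a • ∷ ↑ c ∷ [] ≈ c ∷ a • ∷ []
    •-natural a c = by (begin
      a • ∘ ↑ c                                ≡⟨ C-decompose pos (↑ c) a ⟨
      C pos · ↑ c · a                          ≡⟨ cong (λ x → C pos · x · a) (∘-identityʳ (↑ c)) ⟨
      C pos · (↑ c ∘ I) · a                    ≡⟨ cong (_· a) (B-app _ _ I) ⟨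
      (C pos ∘ ↑ ↑ c) · I · a                  ≡⟨ cong (λ x → x · I · a) (equal (C-natural pos c)) ⟩
      (↑ ↑ c ∘ C pos) · I · a                  ≡⟨ cong (_· a) (B-app _ _ I) ⟩
      (↑ c ∘ (C pos · I)) · a                  ≡⟨ B-app _ _ a ⟩
      c ∘ a •                                  ∎)

  -- Right composition and the arrows of the category.

  module _ where
    open ≈-Reasoning

    B-shift : ∀ c → B ∷ ↑ c ∷ [] ≈ ↑ ↑ c ∷ B ∷ []
    B-shift c = by (sym (B-natural c))

    -- The mirror image of `↑`: composition with `a` on the right. As a diagram it is the point
    -- `a •` fed into the node `B`.
    R : Carrier → Carrier
    R a = a • ∘ B

    R-def : ∀ s a → C s · B · a ≡ R a
    R-def s a = C-decompose s B a

    R-app : ∀ a b → R a · b ≡ b ∘ a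
    R-app a b = trans (cong (_· b) (sym (R-def pos a))) (C-app pos B a b)

    R-split : ∀ a → R a ∷ [] ≈ a • ∷ B ∷ []
    R-split a = by refl

    R-I : R I ∷ [] ≈ []
    R-I = by (trans (sym (R-def pos I)) (CBI pos))

    R-shift : ∀ a c → R a ∷ ↑ c ∷ [] ≈ ↑ c ∷ R a ∷ []
    R-shift a c = begin
      R a ∷ ↑ c ∷ []       ≈⟨ at 0 (R-split a) ⟩
      a • ∷ B ∷ ↑ c ∷ []   ≈⟨ at 1 (B-shift c) ⟩
      a • ∷ ↑ ↑ c ∷ B ∷ [] ≈⟨ at 0 (•-natural a (↑ c)) ⟩
      ↑ c ∷ a • ∷ B ∷ []   ≈⟨ under 1 (R-split a) ⟨
      ↑ c ∷ R a ∷ []       ∎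

    B•BBB : B • ∷ B ∷ B ∷ B ∷ [] ≈ ↑ B ∷ B ∷ []
    B•BBB = begin
      B • ∷ B ∷ B ∷ B ∷ []               ≈⟨ by (sym (∘-assoc _ _ _)) ⟩
      R B ∷ B ∷ B ∷ []                   ≈⟨ at 0 (letter (R-def pos B)) ⟨
      C pos · B · B ∷ B ∷ B ∷ []         ≈⟨ by (let _ , _ , _ , _ , _ , _ , p , _ = ext in p pos) ⟩
      ↑ B ∷ B ∷ []                       ∎

    R-∘ : ∀ a b → R (a ∘ b) ∷ [] ≈ R b ∷ R a ∷ []
    R-∘ a b = begin
      R (a ∘ b) ∷ []                         ≈⟨ R-split _ ⟩
      (B · a · b) • ∷ B ∷ []                 ≈⟨ at 0 (app-• (↑ a) b) ⟩
      b • ∷ (↑ a) • ∷ B ∷ B ∷ []             ≈⟨ at 1 (app-• B a) ⟩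
      b • ∷ a • ∷ B • ∷ B ∷ B ∷ B ∷ []       ≈⟨ at 2 B•BBB ⟩
      b • ∷ a • ∷ ↑ B ∷ B ∷ []               ≈⟨ at 1 (•-natural a B) ⟩
      b • ∷ B ∷ a • ∷ B ∷ []                 ≈⟨ at 0 (R-split b) ⟨
      R b ∷ a • ∷ B ∷ []                     ≈⟨ under 1 (R-split a) ⟨
      R b ∷ R a ∷ []                         ∎

    R-↑ : ∀ a → R (↑ a) ∷ B ∷ [] ≈ B ∷ R a ∷ []
    R-↑ a = begin
      R (↑ a) ∷ B ∷ []             ≈⟨ at 0 (R-split _) ⟩
      (↑ a) • ∷ B ∷ B ∷ []         ≈⟨ at 0 (app-• B a) ⟩
      a • ∷ B • ∷ B ∷ B ∷ B ∷ []   ≈⟨ at 1 B•BBB ⟩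
      a • ∷ ↑ B ∷ B ∷ []           ≈⟨ at 0 (•-natural a B) ⟩
      B ∷ a • ∷ B ∷ []             ≈⟨ under 1 (R-split a) ⟨
      B ∷ R a ∷ []                 ∎

    ↑-•-C : ∀ s a → ↑ (a •) ∷ C s ∷ [] ≈ a • ∷ []
    ↑-•-C s a = begin
      ↑ (a •) ∷ C s ∷ []              ≈⟨ at 0 (↑-• (flip s) a) ⟩
      a • ∷ C (flip s) ∷ C s ∷ []     ≈⟨ at 1 (C-inverse′ s) ⟩
      a • ∷ []                        ∎

    -- Since `R a` is a point followed by a node, the crossing slides past the point by `•-natural`
    -- and past the node by `hexagon`.
    C-R : ∀ s a → C s ∷ R a ∷ [] ≈ ↑ R a ∷ C s ∷ []
    C-R s a = begin
      C s ∷ R a ∷ []                     ≈⟨ under 1 (R-split a) ⟩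
      C s ∷ a • ∷ B ∷ []                 ≈⟨ at 0 (•-natural a (C s)) ⟨
      a • ∷ ↑ C s ∷ B ∷ []               ≈⟨ at 0 (↑-•-C s a) ⟨
      ↑ (a •) ∷ C s ∷ ↑ C s ∷ B ∷ []     ≈⟨ at 1 (hexagon s) ⟨
      ↑ (a •) ∷ ↑ B ∷ C s ∷ []           ≈⟨ at 0 (shift (R-split a)) ⟨
      ↑ R a ∷ C s ∷ []                   ∎

    R-C : ∀ s a → R a ∷ C s ∷ [] ≈ C s ∷ ↑ R a ∷ []
    R-C s a = C-cancelˡ (flip s) (begin
      C (flip s) ∷ R a ∷ C s ∷ []       ≈⟨ at 0 (C-R (flip s) a) ⟩
      ↑ R a ∷ C (flip s) ∷ C s ∷ []     ≈⟨ at 1 (C-inverse′ s) ⟩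
      ↑ R a ∷ []                        ≈⟨ at 0 (C-inverse′ s) ⟨
      C (flip s) ∷ C s ∷ ↑ R a ∷ []     ∎)

    -- Since R f · c = c ∘ f, applying both sides to c says ↑ᵐ c ∘ f = f ∘ ↑ⁿ c.
    Arrow : ℕ → ℕ → Carrier → Set ℓ
    Arrow m n f = R f ∷ replicate m B ≈ ↑ f ∷ replicate n B

    ∘-arrow : ∀ {l m n f g} → Arrow l m f → Arrow m n g → Arrow l n (f ∘ g)
    ∘-arrow {l} {m} {n} {f} {g} p q = begin
      R (f ∘ g) ∷ replicate l B       ≈⟨ at 0 (R-∘ f g) ⟩
      R g ∷ R f ∷ replicate l B       ≈⟨ under 1 p ⟩
      R g ∷ ↑ f ∷ replicate m B       ≈⟨ at 0 (R-shift g f) ⟩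
      ↑ f ∷ R g ∷ replicate m B       ≈⟨ under 1 q ⟩
      ↑ f ∷ ↑ g ∷ replicate n B       ≈⟨ at 0 (↑-split f g) ⟨
      ↑ (f ∘ g) ∷ replicate n B       ∎

    ↑-arrow : ∀ {m n f} → Arrow m n f → Arrow (suc m) (suc n) (↑ f)
    ↑-arrow {m} {n} {f} p = begin
      R (↑ f) ∷ B ∷ replicate m B     ≈⟨ at 0 (R-↑ f) ⟩
      B ∷ R f ∷ replicate m B         ≈⟨ under 1 p ⟩
      B ∷ ↑ f ∷ replicate n B         ≈⟨ at 0 (B-shift f) ⟩
      ↑ ↑ f ∷ B ∷ replicate n B       ∎

    replicate-suc : ∀ n → replicate n B ++ B ∷ [] ≡ replicate (suc n) B
    replicate-suc zero    = refl
    replicate-suc (suc n) = cong (B ∷_) (replicate-suc n)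

    -- A strand added behind leaves `f` as it is; only strands in front are recorded, by `↑`.
    widen : ∀ {m n f} → Arrow m n f → Arrow (suc m) (suc n) f
    widen {m} {n} {f} p = begin
      R f ∷ replicate (suc m) B        ≡⟨ cong (R f ∷_) (replicate-suc m) ⟨
      R f ∷ replicate m B ++ B ∷ []    ≈⟨ ++-congʳ (B ∷ []) p ⟩
      ↑ f ∷ replicate n B ++ B ∷ []    ≡⟨ cong (↑ f ∷_) (replicate-suc n) ⟩
      ↑ f ∷ replicate (suc n) B        ∎

    B-arrow : Arrow 2 1 B
    B-arrow = begin
      R B ∷ B ∷ B ∷ []       ≈⟨ at 0 (R-split B) ⟩
      B • ∷ B ∷ B ∷ B ∷ []   ≈⟨ B•BBB ⟩
      ↑ B ∷ B ∷ []           ∎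

    C-arrow : ∀ s → Arrow 2 2 (C s)
    C-arrow s = begin
      R (C s) ∷ B ∷ B ∷ []         ≈⟨ at 0 (letter (R-def pos (C s))) ⟨
      C pos · B · C s ∷ B ∷ B ∷ [] ≈⟨ by (let _ , _ , _ , _ , _ , _ , _ , _ , p , _ = ext in p pos s) ⟩
      ↑ C s ∷ B ∷ B ∷ []           ∎

    I•B : I • ∷ B ∷ [] ≈ []
    I•B = ≈-trans (≈-sym (R-split I)) R-I

    •-arrow : ∀ a → Arrow 0 1 (a •)
    •-arrow a = begin
      R (a •) ∷ []                             ≈⟨ R-split _ ⟩
      (C pos · I · a) • ∷ B ∷ []               ≈⟨ at 0 (app-• _ a) ⟩
      a • ∷ (C pos · I) • ∷ B ∷ B ∷ []         ≈⟨ at 1 (app-• _ I) ⟩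
      a • ∷ I • ∷ C pos • ∷ B ∷ B ∷ B ∷ []     ≈⟨ at 2 (R-split (C pos)) ⟨
      a • ∷ I • ∷ R (C pos) ∷ B ∷ B ∷ []       ≈⟨ at 2 (C-arrow pos) ⟩
      a • ∷ I • ∷ ↑ C pos ∷ B ∷ B ∷ []         ≈⟨ at 1 (•-natural I (C pos)) ⟩
      a • ∷ C pos ∷ I • ∷ B ∷ B ∷ []           ≈⟨ at 2 I•B ⟩
      a • ∷ C pos ∷ B ∷ []                     ≈⟨ at 0 (↑-• pos a) ⟨
      ↑ (a •) ∷ B ∷ []                         ∎

    R-arrow : ∀ a → Arrow 1 1 (R a)
    R-arrow a = ∘-arrow (widen (•-arrow a)) B-arrow

  -- Naturality of arrows, for composition and for the braiding.

  ↑^ : ℕ → Carrier → Carrier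
  ↑^ zero    c = c
  ↑^ (suc n) c = ↑ ↑^ n c

  module _ where
    open ≡-Reasoning

    ∷-app : ∀ a w c → ⟦ a ∷ w ⟧ · c ≡ a · (⟦ w ⟧ · c)
    ∷-app a w c = trans (cong (_· c) (⟦∷⟧ a w)) (B-app _ _ c)

    replicate-app : ∀ n c → ⟦ replicate n B ⟧ · c ≡ ↑^ n c
    replicate-app zero    c = I-app c
    replicate-app (suc n) c = trans (∷-app B (replicate n B) c) (cong ↑_ (replicate-app n c))

    natural : ∀ {m n f} → Arrow m n f → ∀ c → ↑^ m c ∷ f ∷ [] ≈ f ∷ ↑^ n c ∷ []
    natural {m} {n} {f} p c = by (begin
      ↑^ m c ∘ f                       ≡⟨ R-app f _ ⟨
      R f · ↑^ m c                     ≡⟨ cong (R f ·_) (replicate-app m c) ⟨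
      R f · (⟦ replicate m B ⟧ · c)    ≡⟨ ∷-app (R f) (replicate m B) c ⟨
      ⟦ R f ∷ replicate m B ⟧ · c      ≡⟨ cong (_· c) (equal p) ⟩
      ⟦ ↑ f ∷ replicate n B ⟧ · c      ≡⟨ ∷-app (↑ f) (replicate n B) c ⟩
      f ∘ (⟦ replicate n B ⟧ · c)      ≡⟨ cong (f ∘_) (replicate-app n c) ⟩
      f ∘ ↑^ n c                       ∎)

    replicate-I : ∀ n → ⟦ replicate n B ⟧ · I ≡ I
    replicate-I zero    = I-app I
    replicate-I (suc n) = begin
      ⟦ B ∷ replicate n B ⟧ · I    ≡⟨ ∷-app B (replicate n B) I ⟩
      ↑ (⟦ replicate n B ⟧ · I)    ≡⟨ cong ↑_ (replicate-I n) ⟩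
      ↑ I                          ≡⟨ ↑-I ⟩
      I                            ∎

    -- Evaluation at `I` undoes `↑`, because `I` is a right unit, and erases the trailing nodes,
    -- because `B · I` is `I`.
    unshift : ∀ n {u v} → map ↑_ u ++ replicate n B ≈ map ↑_ v ++ replicate n B → u ≈ v
    unshift n {u} {v} e = by (trans (sym (at-I u)) (trans (cong (_· I) (equal e)) (at-I v)))
      where
      at-I : ∀ w → ⟦ map ↑_ w ++ replicate n B ⟧ · I ≡ ⟦ w ⟧
      at-I w = begin
        ⟦ map ↑_ w ++ replicate n B ⟧ · I           ≡⟨ cong (_· I) (⟦++⟧ (map ↑_ w) _) ⟩
        (⟦ map ↑_ w ⟧ ∘ ⟦ replicate n B ⟧) · I      ≡⟨ B-app _ _ I ⟩
        ⟦ map ↑_ w ⟧ · (⟦ replicate n B ⟧ · I)      ≡⟨ cong₂ _·_ (⟦map-↑⟧ w) (replicate-I n) ⟩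
        ⟦ w ⟧ ∘ I                                   ≡⟨ ∘-identityʳ _ ⟩
        ⟦ w ⟧                                       ∎

  open ≈-Reasoning

  -- The braiding of one strand with n strands.
  σ : Sign → ℕ → List Carrier
  σ s zero    = []
  σ s (suc n) = C s ∷ map ↑_ (σ s n)

  R-shifts : ∀ a u w → R a ∷ map ↑_ u ++ w ≈ map ↑_ u ++ R a ∷ w
  R-shifts a []      w = ≈-refl
  R-shifts a (c ∷ u) w = ≈-trans (at 0 (R-shift a c)) (under 1 (R-shifts a u w))

  B-shifts : ∀ u w → B ∷ map ↑_ u ++ w ≈ map ↑_ (map ↑_ u) ++ B ∷ w
  B-shifts []      w = ≈-refl
  B-shifts (c ∷ u) w = ≈-trans (at 0 (B-shift c)) (under 1 (B-shifts u w))

  replicate-σ : ∀ s n → map ↑_ (replicate n B) ++ C s ∷ [] ≈ C s ∷ map ↑_ (σ s n) ++ replicate n B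
  replicate-σ s zero    = ≈-refl
  replicate-σ s (suc n) = begin
    ↑ B ∷ map ↑_ (replicate n B) ++ C s ∷ []                      ≈⟨ under 1 (replicate-σ s n) ⟩
    ↑ B ∷ C s ∷ map ↑_ (σ s n) ++ replicate n B                   ≈⟨ at 0 (hexagon s) ⟩
    C s ∷ ↑ C s ∷ B ∷ map ↑_ (σ s n) ++ replicate n B             ≈⟨ under 2 (B-shifts (σ s n) _) ⟩
    C s ∷ ↑ C s ∷ map ↑_ (map ↑_ (σ s n)) ++ B ∷ replicate n B    ∎

  map-↑-∷ʳ : ∀ u f w → map ↑_ (u ++ f ∷ []) ++ w ≡ map ↑_ u ++ ↑ f ∷ w
  map-↑-∷ʳ []      f w = refl
  map-↑-∷ʳ (c ∷ u) f w = cong (↑ c ∷_) (map-↑-∷ʳ u f w)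

  -- Both sides of `p` are pulled through a crossing. `R f` passes unchanged by `C-R`, while every
  -- `B` leaves one more crossing by the hexagon, so that `σ s m` and `σ s n` appear. The auxiliary
  -- crossing and the outer `↑` are cancelled at the end.
  braid : ∀ {m n f} → Arrow m n f → ∀ s → σ s m ++ f ∷ [] ≈ ↑ f ∷ σ s n
  braid {m} {n} {f} p s = unshift n (C-cancelˡ s (begin
    C s ∷ map ↑_ (σ s m ++ f ∷ []) ++ replicate n B     ≡⟨ cong (C s ∷_) (map-↑-∷ʳ (σ s m) f _) ⟩
    C s ∷ map ↑_ (σ s m) ++ ↑ f ∷ replicate n B         ≈⟨ under 1 (++-congˡ (map ↑_ (σ s m)) p) ⟨
    C s ∷ map ↑_ (σ s m) ++ R f ∷ replicate m B         ≈⟨ under 1 (R-shifts f (σ s m) _) ⟨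
    C s ∷ R f ∷ map ↑_ (σ s m) ++ replicate m B         ≈⟨ at 0 (C-R s f) ⟩
    ↑ R f ∷ C s ∷ map ↑_ (σ s m) ++ replicate m B       ≈⟨ under 1 (replicate-σ s m) ⟨
    ↑ R f ∷ map ↑_ (replicate m B) ++ C s ∷ []          ≈⟨ ++-congʳ (C s ∷ []) (shift p) ⟩
    ↑ ↑ f ∷ map ↑_ (replicate n B) ++ C s ∷ []          ≈⟨ under 1 (replicate-σ s n) ⟩
    ↑ ↑ f ∷ C s ∷ map ↑_ (σ s n) ++ replicate n B       ≈⟨ at 0 (C-natural s f) ⟨
    C s ∷ ↑ ↑ f ∷ map ↑_ (σ s n) ++ replicate n B       ∎))

  -- Insert the unit `I • ∘ B` behind `f` and move `I •` to the front; then `p` turns `↑ f ∘ B` into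
  -- `R f`, and `app-•` reassembles an application.
  arrow⇒• : ∀ {f} → Arrow 0 1 f → f ∷ [] ≈ (f · I) • ∷ []
  arrow⇒• {f} p = begin
    f ∷ []                 ≈⟨ under 1 I•B ⟨
    f ∷ I • ∷ B ∷ []       ≈⟨ at 0 (•-natural I f) ⟨
    I • ∷ ↑ f ∷ B ∷ []     ≈⟨ under 1 p ⟨
    I • ∷ R f ∷ []         ≈⟨ under 1 (R-split f) ⟩
    I • ∷ f • ∷ B ∷ []     ≈⟨ app-• f I ⟨
    (f · I) • ∷ []         ∎

  arrow⇒R : ∀ {f} → Arrow 1 1 f → f ∷ [] ≈ R (f · I) ∷ []
  arrow⇒R {f} p = begin
    f ∷ []                 ≈⟨ under 1 I•B ⟨
    f ∷ I • ∷ B ∷ []       ≈⟨ at 0 (•-natural I f) ⟨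
    I • ∷ ↑ f ∷ B ∷ []     ≈⟨ under 1 p ⟨
    I • ∷ R f ∷ B ∷ []     ≈⟨ at 1 (R-split f) ⟩
    I • ∷ f • ∷ B ∷ B ∷ [] ≈⟨ at 0 (app-• f I) ⟨
    (f · I) • ∷ B ∷ []     ≈⟨ R-split _ ⟨
    R (f · I) ∷ []         ∎

  ∘B-I : ∀ f → (f ∘ B) · I ≡ f · I
  ∘B-I f = trans (B-app f B I) (cong (f ·_) ↑-I)

  -- A point is determined by its value at `I`, and `f ∘ B` has the same value there as `f`. An
  -- identity between arrows may thus be tested after composing with `B`.
  ∘B≡I⇒I• : ∀ {f} → Arrow 0 1 f → f ∷ B ∷ [] ≈ [] → f ∷ [] ≈ I • ∷ []
  ∘B≡I⇒I• {f} p e = ≈-trans (arrow⇒• p) (by (cong _•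
    (trans (sym (∘B-I f)) (trans (cong (_· I) (equal e)) (I-app I)))))

  ∘B≡B⇒I : ∀ {f} → Arrow 1 1 f → f ∷ B ∷ [] ≈ B ∷ [] → f ∷ [] ≈ []
  ∘B≡B⇒I {f} p e = ≈-trans (arrow⇒R p) (≈-trans (by (cong R
    (trans (sym (∘B-I f)) (trans (cong (_· I) (equal e)) ↑-I)))) R-I)

-- Twists as arrows.

module Balanced {ℓ : Level} (𝒜 : BCI-data ℓ) (ext : BCI-data.IsExtensional 𝒜)
  (θ : Sign → BCI-data.Carrier 𝒜) (bal : BCI-data.IsBalancing 𝒜 θ) where

  open Extensional 𝒜 ext public

  open ≈-Reasoning

  θ-arrow : ∀ s → Arrow 1 1 (θ s)
  θ-arrow s = begin
    R (θ s) ∷ B ∷ []               ≈⟨ at 0 (letter (R-def pos (θ s))) ⟨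
    C pos · B · θ s ∷ B ∷ []       ≈⟨ by (let p , _ = bal in p pos s) ⟨
    ↑ θ s ∷ B ∷ []                 ∎

  θ-inverse : ∀ s → θ s ∷ θ (flip s) ∷ [] ≈ []
  θ-inverse s = by (let _ , p , _ = bal in trans (p s) ↑-I)

  θ-inverse′ : ∀ s → θ (flip s) ∷ θ s ∷ [] ≈ []
  θ-inverse′ pos = θ-inverse neg
  θ-inverse′ neg = θ-inverse pos

  •-θ : ∀ s a → a • ∷ θ s ∷ [] ≈ a • ∷ []
  •-θ s a = by (let _ , _ , p , _ = bal in trans (sym (C-decompose pos (θ s) a)) (p pos s pos a))

  B-θ : ∀ s → B ∷ θ s ∷ [] ≈ θ s ∷ C s ∷ θ s ∷ C s ∷ B ∷ []
  B-θ s = by (let _ , _ , _ , p = bal in p s)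

  θ-shift : ∀ s c → θ s ∷ ↑ c ∷ [] ≈ ↑ c ∷ θ s ∷ []
  θ-shift s c = ≈-sym (natural (θ-arrow s) c)

  C-θ : ∀ t s → C t ∷ θ s ∷ [] ≈ ↑ θ s ∷ C t ∷ []
  C-θ t s = braid (θ-arrow s) t

  θ-C : ∀ t s → θ s ∷ C t ∷ [] ≈ C t ∷ ↑ θ s ∷ []
  θ-C t s = C-cancelˡ (flip t) (begin
    C (flip t) ∷ θ s ∷ C t ∷ []       ≈⟨ at 0 (C-θ (flip t) s) ⟩
    ↑ θ s ∷ C (flip t) ∷ C t ∷ []     ≈⟨ at 1 (C-inverse′ t) ⟩
    ↑ θ s ∷ []                        ≈⟨ at 0 (C-inverse′ t) ⟨
    C (flip t) ∷ C t ∷ ↑ θ s ∷ []     ∎)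

-- From a trace to a ribbon structure: the calculus of traces.

module Traced {ℓ : Level} (𝒜 : BCI-data ℓ) (ext : BCI-data.IsExtensional 𝒜)
  (θ : Sign → BCI-data.Carrier 𝒜) (bal : BCI-data.IsBalancing 𝒜 θ)
  (Tr : BCI-data.Carrier 𝒜) (trace : BCI-data.IsTrace 𝒜 θ Tr) where

  open Balanced 𝒜 ext θ bal

  module _ where
    open ≈-Reasoning

    Tr-arrow : Arrow 1 2 Tr
    Tr-arrow = begin
      R Tr ∷ B ∷ []               ≈⟨ at 0 (letter (R-def pos Tr)) ⟨
      C pos · B · Tr ∷ B ∷ []     ≈⟨ by (let p , _ = trace in p pos) ⟩
      ↑ Tr ∷ B ^ 2 ∷ []           ≈⟨ under 1 (by (cong (B ∘_) (∘-identityʳ B))) ⟩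
      ↑ Tr ∷ B ∷ B ∷ []           ∎

    B-Tr : B ∷ Tr ∷ [] ≈ ↑ Tr ∷ R B ∷ B ∷ []
    B-Tr = begin
      B ∷ Tr ∷ []                       ≈⟨ by (let _ , p , _ = trace in p pos) ⟨
      ↑ Tr ∷ C pos · B · B ∷ B ∷ []     ≈⟨ at 1 (letter (R-def pos B)) ⟩
      ↑ Tr ∷ R B ∷ B ∷ []               ∎

  -- Opaque, so that Agda can infer w from T w.
  opaque
    T : List Carrier → Carrier
    T w = Tr · ⟦ w ⟧

    T-def : ∀ w → T w ≡ Tr · ⟦ w ⟧
    T-def w = refl

  T-cong : ∀ {u v} → u ≈ v → T u ∷ [] ≈ T v ∷ []
  T-cong {u} {v} e = letter (trans (T-def u) (trans (cong (Tr ·_) (equal e)) (sym (T-def v))))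

  module _ where
    open ≡-Reasoning

    -- `B-Tr` evaluated at `f`. It makes a trace, shifted by one strand, an ordinary word: `Tr`
    -- opens the loop and `B` closes it.
    Tr-B· : ∀ f → Tr ∷ ↑ f ∷ B ∷ [] ≈ ↑ (Tr · f) ∷ []
    Tr-B· f = by (begin
      Tr ∘ (↑ f ∘ B)               ≡⟨ cong (Tr ∘_) (R-app B (↑ f)) ⟨
      Tr ∘ (R B · ↑ f)             ≡⟨ cong (Tr ∘_) (B-app (R B) B f) ⟨
      ↑ Tr · ((R B ∘ B) · f)       ≡⟨ B-app (↑ Tr) _ f ⟨
      (↑ Tr ∘ (R B ∘ B)) · f       ≡⟨ cong (_· f) (equal B-Tr) ⟨
      (B ∘ Tr) · f                 ≡⟨ B-app B Tr f ⟩
      ↑ (Tr · f)                   ∎)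

    Tr-B : ∀ w → Tr ∷ ↑ ⟦ w ⟧ ∷ B ∷ [] ≈ ↑ T w ∷ []
    Tr-B w = by (trans (equal (Tr-B· ⟦ w ⟧)) (cong ↑_ (sym (T-def w))))

    -- Tightening. The traced strand stands in front, so whatever avoids it carries `↑`. This side
    -- comes from naturality of `Tr`, the side of `T-right` from `Tr-B`.
    T-left : ∀ a w → T (↑ a ∷ w) ∷ [] ≈ a ∷ T w ∷ []
    T-left a w = by (begin
      T (↑ a ∷ w)                  ≡⟨ T-def _ ⟩
      Tr · ⟦ ↑ a ∷ w ⟧             ≡⟨ cong (Tr ·_) (⟦∷⟧ (↑ a) w) ⟩
      Tr · (↑ a ∘ ⟦ w ⟧)           ≡⟨ B-app Tr (↑ ↑ a) ⟦ w ⟧ ⟨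
      (Tr ∘ ↑ ↑ a) · ⟦ w ⟧         ≡⟨ cong (_· ⟦ w ⟧) (equal (natural Tr-arrow a)) ⟨
      (↑ a ∘ Tr) · ⟦ w ⟧           ≡⟨ B-app (↑ a) Tr ⟦ w ⟧ ⟩
      a ∘ (Tr · ⟦ w ⟧)             ≡⟨ cong (a ∘_) (T-def w) ⟨
      a ∘ T w                      ∎)

    T-right : ∀ w v → T (w ++ map ↑_ v) ∷ [] ≈ T w ∷ v
    T-right w v = by (begin
      T (w ++ map ↑_ v)                 ≡⟨ T-def _ ⟩
      Tr · ⟦ w ++ map ↑_ v ⟧            ≡⟨ cong (Tr ·_) (⟦++⟧ w (map ↑_ v)) ⟩
      Tr · (⟦ w ⟧ ∘ ⟦ map ↑_ v ⟧)       ≡⟨ cong (λ x → Tr · (⟦ w ⟧ ∘ x)) (⟦map-↑⟧ v) ⟩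
      Tr · (⟦ w ⟧ ∘ ↑ ⟦ v ⟧)            ≡⟨ cong (Tr ·_) (B-app (↑ ⟦ w ⟧) B ⟦ v ⟧) ⟨
      Tr · ((↑ ⟦ w ⟧ ∘ B) · ⟦ v ⟧)      ≡⟨ B-app Tr _ ⟦ v ⟧ ⟨
      (Tr ∘ (↑ ⟦ w ⟧ ∘ B)) · ⟦ v ⟧      ≡⟨ cong (_· ⟦ v ⟧) (equal (Tr-B w)) ⟩
      T w ∘ ⟦ v ⟧                       ≡⟨ ⟦∷⟧ (T w) v ⟨
      ⟦ T w ∷ v ⟧                       ∎)

    T-yank : ∀ s v → T (C s ∷ map ↑_ v) ∷ [] ≈ θ s ∷ v
    T-yank s v = ≈-trans (T-right (C s ∷ []) v)
      (at 0 (letter (trans (T-def _) (let _ , _ , p , _ = trace in p s))))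

    TT-def : ∀ w → T (T w ∷ []) ≡ (Tr ^ 2) · ⟦ w ⟧
    TT-def w = begin
      T (T w ∷ [])               ≡⟨ T-def _ ⟩
      Tr · T w                   ≡⟨ cong (Tr ·_) (T-def w) ⟩
      Tr · (Tr · ⟦ w ⟧)          ≡⟨ cong (λ x → Tr · (x · ⟦ w ⟧)) (∘-identityʳ Tr) ⟨
      Tr · ((Tr ∘ I) · ⟦ w ⟧)    ≡⟨ B-app Tr _ ⟦ w ⟧ ⟨
      (Tr ^ 2) · ⟦ w ⟧           ∎

    T-swap-pos : ∀ f → T (T (C pos ∷ f ∷ C neg ∷ []) ∷ []) ∷ [] ≈ T (T (f ∷ []) ∷ []) ∷ []
    T-swap-pos f = by (begin
      T (T (C pos ∷ f ∷ C neg ∷ []) ∷ [])     ≡⟨ TT-def _ ⟩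
      (Tr ^ 2) · (C pos ∘ (f ∘ C neg))        ≡⟨ cong ((Tr ^ 2) ·_) (∘-assoc _ _ _) ⟨
      (Tr ^ 2) · ((C pos ∘ f) ∘ C neg)        ≡⟨ cong ((Tr ^ 2) ·_) (C-app pos B (C neg) _) ⟨
      (Tr ^ 2) · (K · (C pos ∘ f))            ≡⟨ cong ((Tr ^ 2) ·_) (B-app K _ f) ⟨
      (Tr ^ 2) · ((K ∘ ↑ C pos) · f)          ≡⟨ B-app (Tr ^ 2) _ f ⟨
      ((Tr ^ 2) ∘ (K ∘ ↑ C pos)) · f          ≡⟨ cong (_· f) (let _ , _ , _ , p = trace in p pos) ⟩
      (Tr ^ 2) · f                            ≡⟨ TT-def _ ⟨
      T (T (f ∷ []) ∷ [])                     ∎)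
      where K = C pos · B · C neg

  open ≈-Reasoning

  -- The axiom supplies one sign. Applied to the conjugate of `f` by the opposite crossings, it
  -- cancels them and yields the other sign.
  T-swap : ∀ s f → T (T (C s ∷ f ∷ C (flip s) ∷ []) ∷ []) ∷ [] ≈ T (T (f ∷ []) ∷ []) ∷ []
  T-swap pos f = T-swap-pos f
  T-swap neg f = begin
    T (T w ∷ []) ∷ []                                      ≈⟨ T-cong (T-cong (fuse w)) ⟨
    T (T (⟦ w ⟧ ∷ []) ∷ []) ∷ []                           ≈⟨ T-swap-pos ⟦ w ⟧ ⟨
    T (T (C pos ∷ ⟦ w ⟧ ∷ C neg ∷ []) ∷ []) ∷ []           ≈⟨ T-cong (T-cong (at 1 (fuse w))) ⟩
    T (T (C pos ∷ w ++ C neg ∷ []) ∷ []) ∷ []              ≈⟨ T-cong (T-cong (at 0 (C-inverse pos))) ⟩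
    T (T (f ∷ C pos ∷ C neg ∷ []) ∷ []) ∷ []               ≈⟨ T-cong (T-cong (under 1 (C-inverse pos))) ⟩
    T (T (f ∷ []) ∷ []) ∷ []                               ∎
    where w = C neg ∷ f ∷ C pos ∷ []

  T-lefts : ∀ u w → T (map ↑_ u ++ w) ∷ [] ≈ u ++ T w ∷ []
  T-lefts []      w = ≈-refl
  T-lefts (a ∷ u) w = ≈-trans (T-left a (map ↑_ u ++ w)) (under 1 (T-lefts u w))

  -- A trace is an application, so `app-•` splits it into the points of `Tr` and of `⟦ w ⟧`.
  -- Naturality is used for each in turn, and `Tr-B` closes the loop again.
  T-arrow : ∀ {m n w} → Arrow (suc m) (suc n) ⟦ w ⟧ → Arrow m n (T w)
  T-arrow {m} {n} {w} p = begin
    R (T w) ∷ replicate m B                   ≈⟨ at 0 (letter (cong R (T-def w))) ⟩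
    R (Tr · ⟦ w ⟧) ∷ replicate m B            ≈⟨ at 0 (R-split _) ⟩
    (Tr · ⟦ w ⟧) • ∷ B ∷ replicate m B        ≈⟨ at 0 (app-• Tr ⟦ w ⟧) ⟩
    ⟦ w ⟧ • ∷ Tr • ∷ B ∷ B ∷ replicate m B    ≈⟨ at 1 (R-split Tr) ⟨
    ⟦ w ⟧ • ∷ R Tr ∷ B ∷ replicate m B        ≈⟨ at 1 Tr-arrow ⟩
    ⟦ w ⟧ • ∷ ↑ Tr ∷ B ∷ B ∷ replicate m B    ≈⟨ at 0 (•-natural ⟦ w ⟧ Tr) ⟩
    Tr ∷ ⟦ w ⟧ • ∷ B ∷ B ∷ replicate m B      ≈⟨ at 1 (R-split ⟦ w ⟧) ⟨
    Tr ∷ R ⟦ w ⟧ ∷ B ∷ replicate m B          ≈⟨ under 1 p ⟩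
    Tr ∷ ↑ ⟦ w ⟧ ∷ B ∷ replicate n B          ≈⟨ at 0 (Tr-B w) ⟩
    ↑ T w ∷ replicate n B                     ∎

  Tr-C-B : ∀ s → Tr ∷ ↑ C s ∷ B ∷ [] ≈ ↑ θ s ∷ []
  Tr-C-B s = ≈-trans (Tr-B (C s ∷ [])) (shift (T-yank s []))

  Tr-braid : ∀ s → Tr ∷ ↑ C s ∷ C s ∷ [] ≈ C s ∷ ↑ Tr ∷ []
  Tr-braid s = begin
    Tr ∷ ↑ C s ∷ C s ∷ []                                    ≈⟨ at 0 (C-inverse s) ⟨
    C s ∷ C (flip s) ∷ Tr ∷ ↑ C s ∷ C s ∷ []                 ≈⟨ at 1 (braid Tr-arrow (flip s)) ⟩
    C s ∷ ↑ Tr ∷ C (flip s) ∷ ↑ C (flip s) ∷ ↑ C s ∷ C s ∷ [] ≈⟨ at 3 (shift (C-inverse′ s)) ⟩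
    C s ∷ ↑ Tr ∷ C (flip s) ∷ C s ∷ []                       ≈⟨ at 2 (C-inverse′ s) ⟩
    C s ∷ ↑ Tr ∷ []                                          ∎

  -- Superposing: a bystander in front has to cross the traced strand, hence the conjugation. Under
  -- one more `↑` the loop is opened by `Tr` and closed by `B`; the crossings slide out past both
  -- and cancel.
  superpose : ∀ s w → T (C s ∷ map ↑_ w ++ C (flip s) ∷ []) ∷ [] ≈ ↑ T w ∷ []
  superpose s w = unshift 0 (begin
    ↑ T (C s ∷ map ↑_ w ++ C (flip s) ∷ []) ∷ []      ≈⟨ shift (T-cong (under 1 (++-congʳ _ (shift (fuse w))))) ⟨
    ↑ T u ∷ []                                        ≈⟨ Tr-B u ⟨
    Tr ∷ ↑ ⟦ u ⟧ ∷ B ∷ []                             ≈⟨ at 1 (shift (fuse u)) ⟩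
    Tr ∷ ↑ C s ∷ ↑ ↑ f ∷ ↑ C (flip s) ∷ B ∷ []        ≈⟨ under 5 (C-inverse s) ⟨
    Tr ∷ ↑ C s ∷ ↑ ↑ f ∷ ↑ C (flip s) ∷ B ∷ C s ∷ C (flip s) ∷ [] ≈⟨ at 3 (hexagon″ s) ⟨
    Tr ∷ ↑ C s ∷ ↑ ↑ f ∷ C s ∷ ↑ B ∷ C (flip s) ∷ []  ≈⟨ at 2 (C-natural s f) ⟨
    Tr ∷ ↑ C s ∷ C s ∷ ↑ ↑ f ∷ ↑ B ∷ C (flip s) ∷ []  ≈⟨ at 0 (Tr-braid s) ⟩
    C s ∷ ↑ Tr ∷ ↑ ↑ f ∷ ↑ B ∷ C (flip s) ∷ []        ≈⟨ at 1 (shift (Tr-B w)) ⟩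
    C s ∷ ↑ ↑ T w ∷ C (flip s) ∷ []                   ≈⟨ at 0 (C-natural s (T w)) ⟩
    ↑ ↑ T w ∷ C s ∷ C (flip s) ∷ []                   ≈⟨ under 1 (C-inverse s) ⟩
    ↑ ↑ T w ∷ []                                      ∎)
    where
    f = ⟦ w ⟧
    u = C s ∷ ↑ f ∷ C (flip s) ∷ []

  superpose′ : ∀ s w → T (C (flip s) ∷ map ↑_ w ++ C s ∷ []) ∷ [] ≈ ↑ T w ∷ []
  superpose′ pos = superpose neg
  superpose′ neg = superpose pos

  -- After composition with `B` the loop of `Tr` contributes `θ (flip s)` and the loop of `T`
  -- contributes `θ s`, which cancel.
  T-Tr-C : ∀ s → T (Tr ∷ C s ∷ []) ∷ [] ≈ I • ∷ []
  T-Tr-C s = ∘B≡I⇒I• (T-arrow (∘-arrow Tr-arrow (C-arrow s))) (begin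
    T (Tr ∷ C s ∷ []) ∷ B ∷ []                                 ≈⟨ T-right (Tr ∷ C s ∷ []) (B ∷ []) ⟨
    T (Tr ∷ C s ∷ ↑ B ∷ []) ∷ []                               ≈⟨ T-cong (at 1 (shift (C-inverse′ s))) ⟨
    T (Tr ∷ ↑ C (flip s) ∷ ↑ C s ∷ C s ∷ ↑ B ∷ []) ∷ []        ≈⟨ T-cong (at 2 (hexagon′ s)) ⟨
    T (Tr ∷ ↑ C (flip s) ∷ B ∷ C s ∷ []) ∷ []                  ≈⟨ T-cong (at 0 (Tr-C-B (flip s))) ⟩
    T (↑ θ (flip s) ∷ C s ∷ []) ∷ []                           ≈⟨ T-left (θ (flip s)) (C s ∷ []) ⟩
    θ (flip s) ∷ T (C s ∷ []) ∷ []                             ≈⟨ under 1 (T-yank s []) ⟩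
    θ (flip s) ∷ θ s ∷ []                                      ≈⟨ θ-inverse′ s ⟩
    []                                                         ∎)

  -- The self-duality given by the trace.

  α-word : List Carrier
  α-word = I • ∷ Tr ∷ ↑ θ neg ∷ ↑ Tr ∷ R (C pos) ∷ C neg ∷ ↑ B ∷ []

  α : Carrier
  α = ⟦ α-word ⟧

  α-arrow : Arrow 0 2 α
  α-arrow =
    ∘-arrow (•-arrow I)
    (∘-arrow Tr-arrow
    (∘-arrow (↑-arrow (θ-arrow neg))
    (∘-arrow (↑-arrow Tr-arrow)
    (∘-arrow (widen (widen (R-arrow (C pos))))
    (∘-arrow (widen (C-arrow neg))
    (↑-arrow B-arrow))))))

  -- This equation dictates `α-word`. Behind `R (C pos)` the nodes `B` turn it into a genuine
  -- crossing, which the first `Tr` closes up to `θ pos`. The letter `θ neg` is there to cancel that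
  -- twist; the second `Tr` survives.
  α-B : α ∷ ↑ B ∷ [] ≈ Tr ∷ []
  α-B = begin
    α ∷ ↑ B ∷ []
      ≈⟨ at 0 (fuse α-word) ⟩
    I • ∷ Tr ∷ ↑ θ neg ∷ ↑ Tr ∷ R (C pos) ∷ C neg ∷ ↑ B ∷ ↑ B ∷ []
      ≈⟨ at 4 (R-C neg (C pos)) ⟩
    I • ∷ Tr ∷ ↑ θ neg ∷ ↑ Tr ∷ C neg ∷ ↑ R (C pos) ∷ ↑ B ∷ ↑ B ∷ []
      ≈⟨ at 5 (shift (C-arrow pos)) ⟩
    I • ∷ Tr ∷ ↑ θ neg ∷ ↑ Tr ∷ C neg ∷ ↑ ↑ C pos ∷ ↑ B ∷ ↑ B ∷ []
      ≈⟨ at 4 (C-natural neg (C pos)) ⟩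
    I • ∷ Tr ∷ ↑ θ neg ∷ ↑ Tr ∷ ↑ ↑ C pos ∷ C neg ∷ ↑ B ∷ ↑ B ∷ []
      ≈⟨ at 5 (hexagon″ neg) ⟩
    I • ∷ Tr ∷ ↑ θ neg ∷ ↑ Tr ∷ ↑ ↑ C pos ∷ ↑ C pos ∷ B ∷ C neg ∷ ↑ B ∷ []
      ≈⟨ at 3 (shift (Tr-braid pos)) ⟩
    I • ∷ Tr ∷ ↑ θ neg ∷ ↑ C pos ∷ ↑ ↑ Tr ∷ B ∷ C neg ∷ ↑ B ∷ []
      ≈⟨ at 2 (shift (θ-C pos neg)) ⟩
    I • ∷ Tr ∷ ↑ C pos ∷ ↑ ↑ θ neg ∷ ↑ ↑ Tr ∷ B ∷ C neg ∷ ↑ B ∷ []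
      ≈⟨ at 4 (B-shift Tr) ⟨
    I • ∷ Tr ∷ ↑ C pos ∷ ↑ ↑ θ neg ∷ B ∷ ↑ Tr ∷ C neg ∷ ↑ B ∷ []
      ≈⟨ at 3 (B-shift (θ neg)) ⟨
    I • ∷ Tr ∷ ↑ C pos ∷ B ∷ ↑ θ neg ∷ ↑ Tr ∷ C neg ∷ ↑ B ∷ []
      ≈⟨ at 1 (Tr-C-B pos) ⟩
    I • ∷ ↑ θ pos ∷ ↑ θ neg ∷ ↑ Tr ∷ C neg ∷ ↑ B ∷ []
      ≈⟨ at 1 (shift (θ-inverse pos)) ⟩
    I • ∷ ↑ Tr ∷ C neg ∷ ↑ B ∷ []
      ≈⟨ at 0 (•-natural I Tr) ⟩
    Tr ∷ I • ∷ C neg ∷ ↑ B ∷ []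
      ≈⟨ at 1 (↑-• neg I) ⟨
    Tr ∷ ↑ (I •) ∷ ↑ B ∷ []
      ≈⟨ under 1 (shift I•B) ⟩
    Tr ∷ [] ∎

  -- The traced strand starts in front. Two crossings carry it behind the two inputs, `↑ B` fuses it
  -- with the second input, and `B` fuses the result with the first.
  β-word : Sign → List Carrier
  β-word s = C s ∷ ↑ C s ∷ ↑ B ∷ B ∷ []

  β : Sign → Carrier
  β s = T (β-word s)

  β-arrow : ∀ s → Arrow 2 0 (β s)
  β-arrow s = T-arrow
    (∘-arrow (widen (C-arrow s))
    (∘-arrow (↑-arrow (C-arrow s))
    (∘-arrow (↑-arrow B-arrow) B-arrow)))

  -- `superpose` admits `α` into the loop, naturality carries it to `↑ B`, and `α-B` makes it `Tr`.
  -- By `B-Tr` and `T-Tr-C` the two loops disappear, leaving right composition with `I • ∘ B`, that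
  -- is, with `I`.
  α-↑β : ∀ s → α ∷ ↑ β s ∷ [] ≈ []
  α-↑β s = begin
    α ∷ ↑ β s ∷ []
      ≈⟨ under 1 (superpose s (β-word s)) ⟨
    α ∷ T (C s ∷ ↑ C s ∷ ↑ ↑ C s ∷ ↑ ↑ B ∷ ↑ B ∷ C (flip s) ∷ []) ∷ []
      ≈⟨ T-left α _ ⟨
    T (↑ α ∷ C s ∷ ↑ C s ∷ ↑ ↑ C s ∷ ↑ ↑ B ∷ ↑ B ∷ C (flip s) ∷ []) ∷ []
      ≈⟨ T-cong (at 0 (braid α-arrow s)) ⟨
    T (α ∷ ↑ ↑ C s ∷ ↑ ↑ B ∷ ↑ B ∷ C (flip s) ∷ []) ∷ []
      ≈⟨ T-cong (at 0 (natural α-arrow (C s))) ⟨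
    T (C s ∷ α ∷ ↑ ↑ B ∷ ↑ B ∷ C (flip s) ∷ []) ∷ []
      ≈⟨ T-cong (at 1 (natural α-arrow B)) ⟨
    T (C s ∷ B ∷ α ∷ ↑ B ∷ C (flip s) ∷ []) ∷ []
      ≈⟨ T-cong (at 2 α-B) ⟩
    T (C s ∷ B ∷ Tr ∷ C (flip s) ∷ []) ∷ []
      ≈⟨ T-cong (at 1 B-Tr) ⟩
    T (C s ∷ ↑ Tr ∷ R B ∷ B ∷ C (flip s) ∷ []) ∷ []
      ≈⟨ T-cong (under 3 (hexagon′ (flip s))) ⟩
    T (C s ∷ ↑ Tr ∷ R B ∷ ↑ C (flip s) ∷ C (flip s) ∷ ↑ B ∷ []) ∷ []
      ≈⟨ T-cong (at 2 (R-shift B (C (flip s)))) ⟩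
    T (C s ∷ ↑ Tr ∷ ↑ C (flip s) ∷ R B ∷ C (flip s) ∷ ↑ B ∷ []) ∷ []
      ≈⟨ T-cong (at 3 (R-C (flip s) B)) ⟩
    T (C s ∷ ↑ Tr ∷ ↑ C (flip s) ∷ C (flip s) ∷ ↑ R B ∷ ↑ B ∷ []) ∷ []
      ≈⟨ T-right (C s ∷ ↑ Tr ∷ ↑ C (flip s) ∷ C (flip s) ∷ []) (R B ∷ B ∷ []) ⟩
    T (C s ∷ ↑ Tr ∷ ↑ C (flip s) ∷ C (flip s) ∷ []) ∷ R B ∷ B ∷ []
      ≈⟨ at 0 (superpose s (Tr ∷ C (flip s) ∷ [])) ⟩
    ↑ T (Tr ∷ C (flip s) ∷ []) ∷ R B ∷ B ∷ []
      ≈⟨ at 0 (shift (T-Tr-C (flip s))) ⟩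
    ↑ (I •) ∷ R B ∷ B ∷ []
      ≈⟨ at 0 (R-shift B (I •)) ⟨
    R B ∷ ↑ (I •) ∷ B ∷ []
      ≈⟨ under 1 (•-arrow I) ⟨
    R B ∷ R (I •) ∷ []
      ≈⟨ R-∘ (I •) B ⟨
    R (I • ∘ B) ∷ []
      ≈⟨ letter (cong R (equal I•B)) ⟩
    R I ∷ []
      ≈⟨ R-I ⟩
    [] ∎

  Tr-C : ∀ s → ↑ Tr ∷ C s ∷ B ∷ [] ≈ θ (flip s) ∷ C s ∷ []
  Tr-C s = begin
    ↑ Tr ∷ C s ∷ B ∷ []                               ≈⟨ at 2 (shift (C-inverse s)) ⟨
    ↑ Tr ∷ C s ∷ ↑ C s ∷ ↑ C (flip s) ∷ B ∷ []        ≈⟨ at 0 (braid Tr-arrow s) ⟨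
    C s ∷ Tr ∷ ↑ C (flip s) ∷ B ∷ []                  ≈⟨ at 1 (Tr-C-B (flip s)) ⟩
    C s ∷ ↑ θ (flip s) ∷ []                           ≈⟨ θ-C s (flip s) ⟨
    θ (flip s) ∷ C s ∷ []                             ∎

  -- The loop of `Tr` gives `θ (flip s)` and the loop of `β s` gives `θ s`.
  ↑Tr-β : ∀ s → ↑ Tr ∷ β s ∷ [] ≈ B ∷ []
  ↑Tr-β s = begin
    ↑ Tr ∷ β s ∷ []                                          ≈⟨ T-left (↑ Tr) (β-word s) ⟨
    T (↑ ↑ Tr ∷ C s ∷ ↑ C s ∷ ↑ B ∷ B ∷ []) ∷ []             ≈⟨ T-cong (at 0 (C-natural s Tr)) ⟨
    T (C s ∷ ↑ ↑ Tr ∷ ↑ C s ∷ ↑ B ∷ B ∷ []) ∷ []             ≈⟨ T-cong (at 1 (shift (Tr-C s))) ⟩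
    T (C s ∷ ↑ θ (flip s) ∷ ↑ C s ∷ B ∷ []) ∷ []             ≈⟨ T-cong (at 0 (θ-C s (flip s))) ⟨
    T (θ (flip s) ∷ C s ∷ ↑ C s ∷ B ∷ []) ∷ []               ≈⟨ T-cong (under 1 (hexagon s)) ⟨
    T (θ (flip s) ∷ ↑ B ∷ C s ∷ []) ∷ []                     ≈⟨ T-cong (at 0 (θ-shift (flip s) B)) ⟩
    T (↑ B ∷ θ (flip s) ∷ C s ∷ []) ∷ []                     ≈⟨ T-left B _ ⟩
    B ∷ T (θ (flip s) ∷ C s ∷ []) ∷ []                       ≈⟨ under 1 (T-cong (θ-C s (flip s))) ⟩
    B ∷ T (C s ∷ ↑ θ (flip s) ∷ []) ∷ []                     ≈⟨ under 1 (T-yank s (θ (flip s) ∷ [])) ⟩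
    B ∷ θ s ∷ θ (flip s) ∷ []                                ≈⟨ under 1 (θ-inverse s) ⟩
    B ∷ []                                                   ∎

  -- Tested after composing with `B`: naturality of `β s` moves that `B` in front, next to `α`,
  -- where `α-B` applies.
  ↑α-β : ∀ s → ↑ α ∷ β s ∷ [] ≈ []
  ↑α-β s = ≈-trans (≈-sym (fuse (↑ α ∷ β s ∷ [])))
    (∘B≡B⇒I (∘-arrow (↑-arrow α-arrow) (widen (β-arrow s))) (begin
      ↑ α ∘ β s ∷ B ∷ []        ≈⟨ at 0 (fuse (↑ α ∷ β s ∷ [])) ⟩
      ↑ α ∷ β s ∷ B ∷ []        ≈⟨ under 1 (natural (β-arrow s) B) ⟨
      ↑ α ∷ ↑ ↑ B ∷ β s ∷ []    ≈⟨ at 0 (shift α-B) ⟩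
      ↑ Tr ∷ β s ∷ []           ≈⟨ ↑Tr-β s ⟩
      B ∷ []                    ∎))

  -- A counit is determined by its unit, and `α` is the same for both signs.
  β-flip : ∀ s → β s ∷ [] ≈ β (flip s) ∷ []
  β-flip s = begin
    β s ∷ []                              ≈⟨ at 0 (↑α-β (flip s)) ⟨
    ↑ α ∷ β (flip s) ∷ β s ∷ []           ≈⟨ at 1 (natural (β-arrow (flip s)) (β s)) ⟨
    ↑ α ∷ ↑ ↑ β s ∷ β (flip s) ∷ []       ≈⟨ at 0 (shift (α-↑β s)) ⟩
    β (flip s) ∷ []                       ∎

  -- Cyclicity of the counit and the ribbon condition.

  open-loop : ∀ s → T (C (flip s) ∷ ↑ θ (flip s) ∷ B ∷ C s ∷ []) ∷ [] ≈ B ∷ []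
  open-loop s = begin
    T (C (flip s) ∷ ↑ θ (flip s) ∷ B ∷ C s ∷ []) ∷ []
      ≈⟨ T-cong (under 2 (hexagon′ s)) ⟩
    T (C (flip s) ∷ ↑ θ (flip s) ∷ ↑ C s ∷ C s ∷ ↑ B ∷ []) ∷ []
      ≈⟨ T-right (C (flip s) ∷ ↑ θ (flip s) ∷ ↑ C s ∷ C s ∷ []) (B ∷ []) ⟩
    T (C (flip s) ∷ ↑ θ (flip s) ∷ ↑ C s ∷ C s ∷ []) ∷ B ∷ []
      ≈⟨ at 0 (superpose′ s (θ (flip s) ∷ C s ∷ [])) ⟩
    ↑ T (θ (flip s) ∷ C s ∷ []) ∷ B ∷ []
      ≈⟨ at 0 (shift (T-cong (θ-C s (flip s)))) ⟩
    ↑ T (C s ∷ ↑ θ (flip s) ∷ []) ∷ B ∷ []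
      -- The yanked loop leaves `θ s`; the letter `θ (flip s)` was placed in the loop to compensate
      -- it.
      ≈⟨ at 0 (shift (T-yank s (θ (flip s) ∷ []))) ⟩
    ↑ θ s ∷ ↑ θ (flip s) ∷ B ∷ []
      ≈⟨ at 0 (shift (θ-inverse s)) ⟩
    B ∷ [] ∎

  -- The content of the two nested traces in `β-cyclic`, once the letters in front of the inserted
  -- loop are drawn into the inner trace.
  loops : Sign → List Carrier
  loops s = ↑ C s ∷ ↑ ↑ C s ∷ ↑ ↑ B ∷ C (flip s) ∷ ↑ θ (flip s) ∷ B ∷ C s ∷ []

  -- The aim is a word whose first three letters avoid the inner traced strand. What stays inside is
  -- then a single crossing followed by shifted letters, which `T-yank` removes.
  loops-swap : ∀ s → C s ∷ loops s ++ C (flip s) ∷ [] ≈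
    ↑ C (flip s) ∷ ↑ ↑ θ (flip s) ∷ ↑ B ∷ C s ∷ ↑ C s ∷ ↑ B ∷ []
  loops-swap s = begin
    C s ∷ ↑ C s ∷ ↑ ↑ C s ∷ ↑ ↑ B ∷ C (flip s) ∷ ↑ θ (flip s) ∷ B ∷ C s ∷ C (flip s) ∷ []
      ≈⟨ under 7 (C-inverse s) ⟩
    C s ∷ ↑ C s ∷ ↑ ↑ C s ∷ ↑ ↑ B ∷ C (flip s) ∷ ↑ θ (flip s) ∷ B ∷ []
      ≈⟨ at 3 (C-natural (flip s) B) ⟨
    C s ∷ ↑ C s ∷ ↑ ↑ C s ∷ C (flip s) ∷ ↑ ↑ B ∷ ↑ θ (flip s) ∷ B ∷ []
      ≈⟨ at 4 (shift (θ-shift (flip s) B)) ⟨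
    C s ∷ ↑ C s ∷ ↑ ↑ C s ∷ C (flip s) ∷ ↑ θ (flip s) ∷ ↑ ↑ B ∷ B ∷ []
      ≈⟨ under 5 (B-shift B) ⟨
    C s ∷ ↑ C s ∷ ↑ ↑ C s ∷ C (flip s) ∷ ↑ θ (flip s) ∷ B ∷ ↑ B ∷ []
      ≈⟨ at 2 (C-natural (flip s) (C s)) ⟨
    C s ∷ ↑ C s ∷ C (flip s) ∷ ↑ ↑ C s ∷ ↑ θ (flip s) ∷ B ∷ ↑ B ∷ []
      ≈⟨ at 3 (shift (θ-shift (flip s) (C s))) ⟨
    C s ∷ ↑ C s ∷ C (flip s) ∷ ↑ θ (flip s) ∷ ↑ ↑ C s ∷ B ∷ ↑ B ∷ []
      ≈⟨ at 4 (B-shift (C s)) ⟨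
    C s ∷ ↑ C s ∷ C (flip s) ∷ ↑ θ (flip s) ∷ B ∷ ↑ C s ∷ ↑ B ∷ []
      ≈⟨ at 0 (yang-baxter′ s) ⟩
    ↑ C (flip s) ∷ C s ∷ ↑ C s ∷ ↑ θ (flip s) ∷ B ∷ ↑ C s ∷ ↑ B ∷ []
      ≈⟨ at 2 (shift (C-θ s (flip s))) ⟩
    ↑ C (flip s) ∷ C s ∷ ↑ ↑ θ (flip s) ∷ ↑ C s ∷ B ∷ ↑ C s ∷ ↑ B ∷ []
      ≈⟨ at 1 (C-natural s (θ (flip s))) ⟩
    ↑ C (flip s) ∷ ↑ ↑ θ (flip s) ∷ C s ∷ ↑ C s ∷ B ∷ ↑ C s ∷ ↑ B ∷ []
      ≈⟨ at 2 (hexagon s) ⟨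
    ↑ C (flip s) ∷ ↑ ↑ θ (flip s) ∷ ↑ B ∷ C s ∷ ↑ C s ∷ ↑ B ∷ [] ∎

  -- `B-θ` splits the twist of the fused strand. One of its two twists cancels `θ (flip s)`, and
  -- Yang-Baxter brings `β-word s` to the end, behind letters that avoid the traced strand.
  untwist : ∀ s → C (flip s) ∷ ↑ θ (flip s) ∷ B ∷ θ s ∷ C s ∷ B ∷ [] ≈ ↑ θ s ∷ ↑ C s ∷ β-word s
  untwist s = begin
    C (flip s) ∷ ↑ θ (flip s) ∷ B ∷ θ s ∷ C s ∷ B ∷ []
      ≈⟨ at 2 (B-θ s) ⟩
    C (flip s) ∷ ↑ θ (flip s) ∷ θ s ∷ C s ∷ θ s ∷ C s ∷ B ∷ C s ∷ B ∷ []
      ≈⟨ at 0 (θ-C (flip s) (flip s)) ⟨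
    θ (flip s) ∷ C (flip s) ∷ θ s ∷ C s ∷ θ s ∷ C s ∷ B ∷ C s ∷ B ∷ []
      ≈⟨ at 1 (C-θ (flip s) s) ⟩
    θ (flip s) ∷ ↑ θ s ∷ C (flip s) ∷ C s ∷ θ s ∷ C s ∷ B ∷ C s ∷ B ∷ []
      ≈⟨ at 2 (C-inverse′ s) ⟩
    θ (flip s) ∷ ↑ θ s ∷ θ s ∷ C s ∷ B ∷ C s ∷ B ∷ []
      ≈⟨ at 1 (θ-shift s (θ s)) ⟨
    θ (flip s) ∷ θ s ∷ ↑ θ s ∷ C s ∷ B ∷ C s ∷ B ∷ []
      ≈⟨ at 0 (θ-inverse′ s) ⟩
    ↑ θ s ∷ C s ∷ B ∷ C s ∷ B ∷ []
      ≈⟨ at 2 (hexagon′ s) ⟩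
    ↑ θ s ∷ C s ∷ ↑ C s ∷ C s ∷ ↑ B ∷ B ∷ []
      ≈⟨ at 1 (yang-baxter s) ⟨
    ↑ θ s ∷ ↑ C s ∷ C s ∷ ↑ C s ∷ ↑ B ∷ B ∷ [] ∎

  -- β s traces x (y z) over z. Inserting a second loop around the strand y z, exchanging
  -- the two loops and removing the one around z turns it into the trace of y (x z).
  β-cyclic : ∀ s → β s ∷ [] ≈ θ s ∷ C s ∷ β s ∷ []
  β-cyclic s = begin
    β s ∷ []
      ≈⟨ T-cong (under 3 (open-loop s)) ⟨
    T (C s ∷ ↑ C s ∷ ↑ B ∷ T (C (flip s) ∷ ↑ θ (flip s) ∷ B ∷ C s ∷ []) ∷ []) ∷ []
      ≈⟨ T-cong (T-lefts (C s ∷ ↑ C s ∷ ↑ B ∷ []) _) ⟨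
    T (T (loops s) ∷ []) ∷ []
      ≈⟨ T-cong (T-cong (fuse (loops s))) ⟨
    T (T (⟦ loops s ⟧ ∷ []) ∷ []) ∷ []
      ≈⟨ T-swap s ⟦ loops s ⟧ ⟨
    T (T (C s ∷ ⟦ loops s ⟧ ∷ C (flip s) ∷ []) ∷ []) ∷ []
      ≈⟨ T-cong (T-cong (at 1 (fuse (loops s)))) ⟩
    T (T (C s ∷ loops s ++ C (flip s) ∷ []) ∷ []) ∷ []
      ≈⟨ T-cong (T-cong (loops-swap s)) ⟩
    T (T (↑ C (flip s) ∷ ↑ ↑ θ (flip s) ∷ ↑ B ∷ C s ∷ ↑ C s ∷ ↑ B ∷ []) ∷ []) ∷ []
      ≈⟨ T-cong (T-lefts (C (flip s) ∷ ↑ θ (flip s) ∷ B ∷ []) _) ⟩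
    T (C (flip s) ∷ ↑ θ (flip s) ∷ B ∷ T (C s ∷ ↑ C s ∷ ↑ B ∷ []) ∷ []) ∷ []
      ≈⟨ T-cong (under 3 (T-yank s (C s ∷ B ∷ []))) ⟩
    T (C (flip s) ∷ ↑ θ (flip s) ∷ B ∷ θ s ∷ C s ∷ B ∷ []) ∷ []
      ≈⟨ T-cong (untwist s) ⟩
    T (↑ θ s ∷ ↑ C s ∷ β-word s) ∷ []
      ≈⟨ T-lefts (θ s ∷ C s ∷ []) (β-word s) ⟩
    θ s ∷ C s ∷ β s ∷ [] ∎

  -- Cyclicity for `flip s` undoes a twist and a crossing; cyclicity for `s` puts them back in, and
  -- moving the twist through the crossing changes its strand.
  θ-β : ∀ s → θ s ∷ β pos ∷ [] ≈ ↑ θ s ∷ β pos ∷ []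
  θ-β s = C-cancelˡ s (begin
    C s ∷ θ s ∷ β pos ∷ []                                   ≈⟨ under 2 cyclic⁻ ⟩
    C s ∷ θ s ∷ θ (flip s) ∷ C (flip s) ∷ β pos ∷ []         ≈⟨ at 1 (θ-inverse s) ⟩
    C s ∷ C (flip s) ∷ β pos ∷ []                            ≈⟨ at 0 (C-inverse s) ⟩
    β pos ∷ []                                               ≈⟨ cyclic⁺ ⟩
    θ s ∷ C s ∷ β pos ∷ []                                   ≈⟨ at 0 (θ-C s s) ⟩
    C s ∷ ↑ θ s ∷ β pos ∷ []                                 ∎)
    where
    β-pos : ∀ t → β t ∷ [] ≈ β pos ∷ []
    β-pos pos = ≈-refl
    β-pos neg = β-flip neg
    cyclic : ∀ t → β pos ∷ [] ≈ θ t ∷ C t ∷ β pos ∷ []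
    cyclic t = ≈-trans (≈-sym (β-pos t)) (≈-trans (β-cyclic t) (under 2 (β-pos t)))
    cyclic⁺ = cyclic s
    cyclic⁻ = cyclic (flip s)

  -- The transpose of `θ-β` along the two snake equations.
  α-θ : ∀ s → α ∷ θ s ∷ [] ≈ α ∷ ↑ θ s ∷ []
  α-θ s = ≈-sym (begin
    α ∷ ↑ θ s ∷ []                          ≈⟨ under 2 (shift (↑α-β pos)) ⟨
    α ∷ ↑ θ s ∷ ↑ ↑ α ∷ ↑ β pos ∷ []        ≈⟨ at 1 (shift (θ-shift s α)) ⟩
    α ∷ ↑ ↑ α ∷ ↑ θ s ∷ ↑ β pos ∷ []        ≈⟨ at 0 (natural α-arrow α) ⟨
    α ∷ α ∷ ↑ θ s ∷ ↑ β pos ∷ []            ≈⟨ under 2 (shift (θ-β s)) ⟩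
    α ∷ α ∷ ↑ ↑ θ s ∷ ↑ β pos ∷ []          ≈⟨ at 1 (natural α-arrow (θ s)) ⟨
    α ∷ θ s ∷ α ∷ ↑ β pos ∷ []              ≈⟨ under 2 (α-↑β pos) ⟩
    α ∷ θ s ∷ []                            ∎)

  ribbon : IsRibbon θ α (β pos)
  ribbon =
    ( equal (begin
        α • ∷ B ∷ []              ≈⟨ R-split α ⟨
        R α ∷ []                  ≈⟨ α-arrow ⟩
        ↑ α ∷ B ∷ B ∷ []          ≈⟨ under 1 (by (cong (B ∘_) (∘-identityʳ B))) ⟨
        ↑ α ∷ B ^ 2 ∷ []          ∎)
    , equal (begin
        β pos • ∷ B ^ 3 ∷ []      ≈⟨ under 1 (by (cong (λ x → B ∘ (B ∘ x)) (∘-identityʳ B))) ⟩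
        β pos • ∷ B ∷ B ∷ B ∷ []  ≈⟨ at 0 (R-split (β pos)) ⟨
        R (β pos) ∷ B ∷ B ∷ []    ≈⟨ β-arrow pos ⟩
        ↑ β pos ∷ []              ∎)
    , trans (equal (α-↑β pos)) (sym ↑-I)
    , trans (equal (↑α-β pos)) (sym ↑-I))
    , λ s → equal (α-θ s)

-- From a ribbon structure to a trace: twisting the counit.

module Ribbon {ℓ : Level} (𝒜 : BCI-data ℓ) (ext : BCI-data.IsExtensional 𝒜)
  (θ : Sign → BCI-data.Carrier 𝒜) (bal : BCI-data.IsBalancing 𝒜 θ)
  (α β : BCI-data.Carrier 𝒜) (rib : BCI-data.IsRibbon 𝒜 θ α β) where

  open Balanced 𝒜 ext θ bal

  open ≈-Reasoning

  α-arrow : Arrow 0 2 α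
  α-arrow = begin
    R α ∷ []                  ≈⟨ R-split α ⟩
    α • ∷ B ∷ []              ≈⟨ by (let (p , _) , _ = rib in p) ⟩
    ↑ α ∷ B ^ 2 ∷ []          ≈⟨ under 1 (by (cong (B ∘_) (∘-identityʳ B))) ⟩
    ↑ α ∷ B ∷ B ∷ []          ∎

  β-arrow : Arrow 2 0 β
  β-arrow = begin
    R β ∷ B ∷ B ∷ []          ≈⟨ at 0 (R-split β) ⟩
    β • ∷ B ∷ B ∷ B ∷ []      ≈⟨ under 1 (by (cong (λ x → B ∘ (B ∘ x)) (∘-identityʳ B))) ⟨
    β • ∷ B ^ 3 ∷ []          ≈⟨ by (let (_ , p , _) , _ = rib in p) ⟩
    ↑ β ∷ []                  ∎

  α-↑β : α ∷ ↑ β ∷ [] ≈ []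
  α-↑β = by (let (_ , _ , p , _) , _ = rib in trans p ↑-I)

  ↑α-β : ↑ α ∷ β ∷ [] ≈ []
  ↑α-β = by (let (_ , _ , _ , p) , _ = rib in trans p ↑-I)

  α-θ : ∀ s → α ∷ θ s ∷ [] ≈ α ∷ ↑ θ s ∷ []
  α-θ s = by (let _ , p = rib in p s)

  θ-β : ∀ s → θ s ∷ β ∷ [] ≈ ↑ θ s ∷ β ∷ []
  θ-β s = begin
    θ s ∷ β ∷ []                    ≈⟨ at 0 ↑α-β ⟨
    ↑ α ∷ β ∷ θ s ∷ β ∷ []          ≈⟨ at 1 (natural β-arrow (θ s)) ⟨
    ↑ α ∷ ↑ ↑ θ s ∷ β ∷ β ∷ []      ≈⟨ at 0 (shift (α-θ s)) ⟨
    ↑ α ∷ ↑ θ s ∷ β ∷ β ∷ []        ≈⟨ under 2 (natural β-arrow β) ⟨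
    ↑ α ∷ ↑ θ s ∷ ↑ ↑ β ∷ β ∷ []    ≈⟨ at 1 (shift (θ-shift s β)) ⟩
    ↑ α ∷ ↑ ↑ β ∷ ↑ θ s ∷ β ∷ []    ≈⟨ at 0 (shift α-↑β) ⟩
    ↑ θ s ∷ β ∷ []                  ∎

  -- Expand the twist of the node by `B-θ`: the point `a •` absorbs one twist and both crossings,
  -- and the other twist comes out in front.
  R-θ : ∀ s a → R a ∷ θ s ∷ [] ≈ θ s ∷ R a ∷ []
  R-θ s a = begin
    R a ∷ θ s ∷ []                            ≈⟨ at 0 (R-split a) ⟩
    a • ∷ B ∷ θ s ∷ []                        ≈⟨ under 1 (B-θ s) ⟩
    a • ∷ θ s ∷ C s ∷ θ s ∷ C s ∷ B ∷ []      ≈⟨ at 0 (•-θ s a) ⟩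
    a • ∷ C s ∷ θ s ∷ C s ∷ B ∷ []            ≈⟨ at 0 (↑-• s a) ⟨
    ↑ (a •) ∷ θ s ∷ C s ∷ B ∷ []              ≈⟨ at 0 (θ-shift s (a •)) ⟨
    θ s ∷ ↑ (a •) ∷ C s ∷ B ∷ []              ≈⟨ at 1 (↑-•-C s a) ⟩
    θ s ∷ a • ∷ B ∷ []                        ≈⟨ under 1 (R-split a) ⟨
    θ s ∷ R a ∷ []                            ∎

  B-θ₂ : ∀ s → B ∷ θ s ∷ [] ≈ θ s ∷ ↑ θ s ∷ C s ∷ C s ∷ B ∷ []
  B-θ₂ s = ≈-trans (B-θ s) (at 1 (C-θ s s))

  -- Both sides are the full twist on three strands, built up from the first pair of strands or from
  -- the last.
  full-twist : ∀ s → C s ∷ C s ∷ ↑ C s ∷ C s ∷ C s ∷ ↑ C s ∷ []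
                   ≈ ↑ C s ∷ ↑ C s ∷ C s ∷ ↑ C s ∷ ↑ C s ∷ C s ∷ []
  full-twist s = begin
    C s ∷ C s ∷ ↑ C s ∷ C s ∷ C s ∷ ↑ C s ∷ []         ≈⟨ at 1 (yang-baxter s) ⟨
    C s ∷ ↑ C s ∷ C s ∷ ↑ C s ∷ C s ∷ ↑ C s ∷ []       ≈⟨ at 0 (yang-baxter s) ⟨
    ↑ C s ∷ C s ∷ ↑ C s ∷ ↑ C s ∷ C s ∷ ↑ C s ∷ []     ≈⟨ under 3 (yang-baxter s) ⟩
    ↑ C s ∷ C s ∷ ↑ C s ∷ C s ∷ ↑ C s ∷ C s ∷ []       ≈⟨ at 1 (yang-baxter s) ⟨
    ↑ C s ∷ ↑ C s ∷ C s ∷ ↑ C s ∷ ↑ C s ∷ C s ∷ []     ∎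

  B-C-C-B : ∀ s → B ∷ C s ∷ C s ∷ B ∷ [] ≈ ↑ C s ∷ C s ∷ C s ∷ ↑ C s ∷ B ∷ B ∷ []
  B-C-C-B s = begin
    B ∷ C s ∷ C s ∷ B ∷ []                   ≈⟨ at 0 (hexagon′ s) ⟩
    ↑ C s ∷ C s ∷ ↑ B ∷ C s ∷ B ∷ []         ≈⟨ at 2 (hexagon s) ⟩
    ↑ C s ∷ C s ∷ C s ∷ ↑ C s ∷ B ∷ B ∷ []   ∎

  R-CC : ∀ s a → R a ∷ C s ∷ C s ∷ [] ≈ C s ∷ C s ∷ R a ∷ []
  R-CC s a = ≈-trans (at 0 (R-C s a)) (under 1 (≈-sym (C-R s a)))

  -- Move the twist on three strands through R β ∘ B ∘ B ≈ ↑ β.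
  twist-β : ∀ s → β ∷ [] ≈ θ s ∷ ↑ θ s ∷ C s ∷ C s ∷ β ∷ []
  twist-β s = unshift 0 (begin
    ↑ β ∷ []
      ≈⟨ at 0 (θ-inverse′ s) ⟨
    θ (flip s) ∷ θ s ∷ ↑ β ∷ []
      ≈⟨ under 1 (θ-shift s β) ⟩
    θ (flip s) ∷ ↑ β ∷ θ s ∷ []
      ≈⟨ at 1 β-arrow ⟨
    θ (flip s) ∷ R β ∷ B ∷ B ∷ θ s ∷ []
      ≈⟨ under 3 (B-θ₂ s) ⟩
    θ (flip s) ∷ R β ∷ B ∷ θ s ∷ ↑ θ s ∷ C s ∷ C s ∷ B ∷ []
      ≈⟨ at 2 (B-θ₂ s) ⟩
    θ (flip s) ∷ R β ∷ θ s ∷ ↑ θ s ∷ C s ∷ C s ∷ B ∷ ↑ θ s ∷ C s ∷ C s ∷ B ∷ []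
      ≈⟨ at 1 (R-θ s β) ⟩
    θ (flip s) ∷ θ s ∷ R β ∷ ↑ θ s ∷ C s ∷ C s ∷ B ∷ ↑ θ s ∷ C s ∷ C s ∷ B ∷ []
      ≈⟨ at 0 (θ-inverse′ s) ⟩
    R β ∷ ↑ θ s ∷ C s ∷ C s ∷ B ∷ ↑ θ s ∷ C s ∷ C s ∷ B ∷ []
      ≈⟨ at 0 (R-shift β (θ s)) ⟩
    ↑ θ s ∷ R β ∷ C s ∷ C s ∷ B ∷ ↑ θ s ∷ C s ∷ C s ∷ B ∷ []
      ≈⟨ at 4 (B-shift (θ s)) ⟩
    ↑ θ s ∷ R β ∷ C s ∷ C s ∷ ↑ ↑ θ s ∷ B ∷ C s ∷ C s ∷ B ∷ []
      ≈⟨ at 3 (C-natural s (θ s)) ⟩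
    ↑ θ s ∷ R β ∷ C s ∷ ↑ ↑ θ s ∷ C s ∷ B ∷ C s ∷ C s ∷ B ∷ []
      ≈⟨ at 2 (C-natural s (θ s)) ⟩
    ↑ θ s ∷ R β ∷ ↑ ↑ θ s ∷ C s ∷ C s ∷ B ∷ C s ∷ C s ∷ B ∷ []
      ≈⟨ at 1 (R-shift β (↑ θ s)) ⟩
    ↑ θ s ∷ ↑ ↑ θ s ∷ R β ∷ C s ∷ C s ∷ B ∷ C s ∷ C s ∷ B ∷ []
      ≈⟨ under 5 (B-C-C-B s) ⟩
    ↑ θ s ∷ ↑ ↑ θ s ∷ R β ∷ C s ∷ C s ∷ ↑ C s ∷ C s ∷ C s ∷ ↑ C s ∷ B ∷ B ∷ []
      ≈⟨ at 2 (R-CC s β) ⟩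
    ↑ θ s ∷ ↑ ↑ θ s ∷ C s ∷ C s ∷ R β ∷ ↑ C s ∷ C s ∷ C s ∷ ↑ C s ∷ B ∷ B ∷ []
      ≈⟨ at 4 (R-shift β (C s)) ⟩
    ↑ θ s ∷ ↑ ↑ θ s ∷ C s ∷ C s ∷ ↑ C s ∷ R β ∷ C s ∷ C s ∷ ↑ C s ∷ B ∷ B ∷ []
      ≈⟨ at 5 (R-CC s β) ⟩
    ↑ θ s ∷ ↑ ↑ θ s ∷ C s ∷ C s ∷ ↑ C s ∷ C s ∷ C s ∷ R β ∷ ↑ C s ∷ B ∷ B ∷ []
      ≈⟨ at 7 (R-shift β (C s)) ⟩
    ↑ θ s ∷ ↑ ↑ θ s ∷ C s ∷ C s ∷ ↑ C s ∷ C s ∷ C s ∷ ↑ C s ∷ R β ∷ B ∷ B ∷ []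
      ≈⟨ under 8 β-arrow ⟩
    ↑ θ s ∷ ↑ ↑ θ s ∷ C s ∷ C s ∷ ↑ C s ∷ C s ∷ C s ∷ ↑ C s ∷ ↑ β ∷ []
      -- In this form the last four crossings are those of one strand with the two inputs of `β`.
      -- Since `β` has no outputs, they vanish, and only the double crossing of the two inputs
      -- remains.
      ≈⟨ at 2 (full-twist s) ⟩
    ↑ θ s ∷ ↑ ↑ θ s ∷ ↑ C s ∷ ↑ C s ∷ C s ∷ ↑ C s ∷ ↑ C s ∷ C s ∷ ↑ β ∷ []
      ≈⟨ under 6 β-braid ⟩
    ↑ θ s ∷ ↑ ↑ θ s ∷ ↑ C s ∷ ↑ C s ∷ C s ∷ ↑ C s ∷ β ∷ []
      ≈⟨ under 4 (braid β-arrow s) ⟩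
    ↑ θ s ∷ ↑ ↑ θ s ∷ ↑ C s ∷ ↑ C s ∷ ↑ β ∷ [] ∎)
    where
    β-braid : ↑ C s ∷ C s ∷ ↑ β ∷ [] ≈ β ∷ []
    β-braid = begin
      ↑ C s ∷ C s ∷ ↑ β ∷ []                                   ≈⟨ under 2 (braid β-arrow (flip s)) ⟨
      ↑ C s ∷ C s ∷ C (flip s) ∷ ↑ C (flip s) ∷ β ∷ []         ≈⟨ at 1 (C-inverse s) ⟩
      ↑ C s ∷ ↑ C (flip s) ∷ β ∷ []                            ≈⟨ at 0 (shift (C-inverse s)) ⟩
      β ∷ []                                                   ∎

  -- The trace built from the duality.

  γ-word : Sign → List Carrier
  γ-word s = C s ∷ θ s ∷ β ∷ []

  γ-sign : γ-word neg ≈ γ-word pos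
  γ-sign = begin
    C neg ∷ θ neg ∷ β ∷ []                                        ≈⟨ under 2 (twist-β pos) ⟩
    C neg ∷ θ neg ∷ θ pos ∷ ↑ θ pos ∷ C pos ∷ C pos ∷ β ∷ []      ≈⟨ at 1 (θ-inverse neg) ⟩
    C neg ∷ ↑ θ pos ∷ C pos ∷ C pos ∷ β ∷ []                      ≈⟨ at 0 (θ-C neg pos) ⟨
    θ pos ∷ C neg ∷ C pos ∷ C pos ∷ β ∷ []                        ≈⟨ at 1 (C-inverse neg) ⟩
    θ pos ∷ C pos ∷ β ∷ []                                        ≈⟨ at 0 (θ-C pos pos) ⟩
    C pos ∷ ↑ θ pos ∷ β ∷ []                                      ≈⟨ under 1 (θ-β pos) ⟨
    C pos ∷ θ pos ∷ β ∷ []                                        ∎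

  γ : Carrier
  γ = ⟦ γ-word pos ⟧

  γ-def : ∀ s → γ ∷ [] ≈ C s ∷ θ s ∷ β ∷ []
  γ-def pos = fuse (γ-word pos)
  γ-def neg = ≈-trans (fuse (γ-word pos)) (≈-sym γ-sign)

  γ-arrow : Arrow 2 0 γ
  γ-arrow = ∘-arrow (C-arrow pos) (∘-arrow (widen (θ-arrow pos)) β-arrow)

  α-braid : ∀ s → α ∷ ↑ C s ∷ C s ∷ [] ≈ ↑ α ∷ []
  α-braid s = begin
    α ∷ ↑ C s ∷ C s ∷ []                                       ≈⟨ at 0 (braid α-arrow (flip s)) ⟩
    ↑ α ∷ C (flip s) ∷ ↑ C (flip s) ∷ ↑ C s ∷ C s ∷ []         ≈⟨ at 2 (shift (C-inverse′ s)) ⟩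
    ↑ α ∷ C (flip s) ∷ C s ∷ []                                ≈⟨ under 1 (C-inverse′ s) ⟩
    ↑ α ∷ []                                                   ∎

  -- The inner unit leaves the outer one across its second strand and reenters across the first. The
  -- two passages use opposite signs, so one crossing of each cancels and the other moves.
  α-α-C : ∀ s → α ∷ ↑ α ∷ ↑ ↑ C s ∷ [] ≈ α ∷ ↑ α ∷ C s ∷ []
  α-α-C s = begin
    α ∷ ↑ α ∷ ↑ ↑ C s ∷ []                                     ≈⟨ at 1 (shift (braid α-arrow (flip s))) ⟩
    α ∷ ↑ ↑ α ∷ ↑ C (flip s) ∷ ↑ ↑ C (flip s) ∷ ↑ ↑ C s ∷ []   ≈⟨ under 3 (shift (shift (C-inverse′ s))) ⟩
    α ∷ ↑ ↑ α ∷ ↑ C (flip s) ∷ []                              ≈⟨ at 0 (natural α-arrow α) ⟨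
    α ∷ α ∷ ↑ C (flip s) ∷ []                                  ≈⟨ at 1 (braid α-arrow s) ⟩
    α ∷ ↑ α ∷ C s ∷ ↑ C s ∷ ↑ C (flip s) ∷ []                  ≈⟨ under 3 (shift (C-inverse s)) ⟩
    α ∷ ↑ α ∷ C s ∷ []                                         ∎

  -- The same manoeuvre for two nested copies of `γ`.
  C-γ-γ : ∀ s → C s ∷ ↑ ↑ C (flip s) ∷ ↑ γ ∷ γ ∷ [] ≈ ↑ γ ∷ γ ∷ []
  C-γ-γ s = begin
    C s ∷ ↑ ↑ C (flip s) ∷ ↑ γ ∷ γ ∷ []                              ≈⟨ at 1 (shift (C-inverse s)) ⟨
    C s ∷ ↑ C s ∷ ↑ C (flip s) ∷ ↑ ↑ C (flip s) ∷ ↑ γ ∷ γ ∷ []       ≈⟨ at 2 (shift (braid γ-arrow (flip s))) ⟩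
    C s ∷ ↑ C s ∷ ↑ ↑ γ ∷ γ ∷ []                                     ≈⟨ under 2 (natural γ-arrow γ) ⟩
    C s ∷ ↑ C s ∷ γ ∷ γ ∷ []                                         ≈⟨ at 0 (braid γ-arrow s) ⟩
    ↑ γ ∷ γ ∷ []                                                     ∎

  Tr-word : List Carrier
  Tr-word = ↑ α ∷ R γ ∷ B ∷ []

  -- Tr · f = α ∘ ↑ f ∘ γ.
  Tr : Carrier
  Tr = ⟦ Tr-word ⟧

  Tr-arrow : Arrow 1 2 Tr
  Tr-arrow = ∘-arrow (↑-arrow α-arrow)
    (∘-arrow (widen (widen (R-arrow γ))) (widen B-arrow))

  B-Tr : ↑ Tr ∷ R B ∷ B ∷ [] ≈ B ∷ Tr ∷ []
  B-Tr = begin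
    ↑ Tr ∷ R B ∷ B ∷ []                            ≈⟨ at 0 (shift (fuse Tr-word)) ⟩
    ↑ ↑ α ∷ ↑ R γ ∷ ↑ B ∷ R B ∷ B ∷ []             ≈⟨ at 2 (R-shift B B) ⟨
    ↑ ↑ α ∷ ↑ R γ ∷ R B ∷ ↑ B ∷ B ∷ []             ≈⟨ under 3 B-arrow ⟨
    ↑ ↑ α ∷ ↑ R γ ∷ R B ∷ R B ∷ B ∷ B ∷ []         ≈⟨ at 1 (R-shift B (R γ)) ⟨
    ↑ ↑ α ∷ R B ∷ ↑ R γ ∷ R B ∷ B ∷ B ∷ []         ≈⟨ at 2 (R-shift B (R γ)) ⟨
    ↑ ↑ α ∷ R B ∷ R B ∷ ↑ R γ ∷ B ∷ B ∷ []         ≈⟨ at 3 (R-arrow γ) ⟨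
    ↑ ↑ α ∷ R B ∷ R B ∷ R (R γ) ∷ B ∷ B ∷ []       ≈⟨ at 1 (R-∘ B B) ⟨
    ↑ ↑ α ∷ R (B ∘ B) ∷ R (R γ) ∷ B ∷ B ∷ []       ≈⟨ at 1 (R-∘ (R γ) (B ∘ B)) ⟨
    -- `γ-arrow` is itself an equation between elements of the algebra, so `R` may be applied to it.
    ↑ ↑ α ∷ R (R γ ∘ (B ∘ B)) ∷ B ∷ B ∷ []         ≈⟨ at 1 (letter (cong R (equal γ-arrow))) ⟩
    ↑ ↑ α ∷ R (↑ γ) ∷ B ∷ B ∷ []                   ≈⟨ at 1 (R-↑ γ) ⟩
    ↑ ↑ α ∷ B ∷ R γ ∷ B ∷ []                       ≈⟨ at 0 (B-shift α) ⟨
    B ∷ ↑ α ∷ R γ ∷ B ∷ []                         ≈⟨ under 1 (fuse Tr-word) ⟨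
    B ∷ Tr ∷ []                                    ∎

  Tr-C : ∀ s → Tr · C s ≡ θ s
  Tr-C s = trans app (equal (begin
    -- `γ` is written with the sign of the crossing to be yanked, so that `α-braid` absorbs both
    -- crossings.
    α ∷ ↑ C s ∷ γ ∷ []               ≈⟨ under 2 (γ-def s) ⟩
    α ∷ ↑ C s ∷ C s ∷ θ s ∷ β ∷ []   ≈⟨ at 0 (α-braid s) ⟩
    ↑ α ∷ θ s ∷ β ∷ []               ≈⟨ at 0 (θ-shift s α) ⟨
    θ s ∷ ↑ α ∷ β ∷ []               ≈⟨ under 1 ↑α-β ⟩
    θ s ∷ []                         ∎))
    where
    app : Tr · C s ≡ α ∘ (↑ C s ∘ γ)
    app = trans (B-app _ _ (C s)) (cong (α ∘_)
      (trans (B-app (R γ) B (C s)) (R-app γ (↑ C s))))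

  Tr-Tr : Tr ∷ Tr ∷ [] ≈ ↑ α ∷ ↑ ↑ α ∷ R (↑ γ ∘ γ) ∷ B ∷ B ∷ []
  Tr-Tr = begin
    Tr ∷ Tr ∷ []                                      ≈⟨ at 0 (fuse Tr-word) ⟩
    ↑ α ∷ R γ ∷ B ∷ Tr ∷ []                           ≈⟨ under 3 (fuse Tr-word) ⟩
    ↑ α ∷ R γ ∷ B ∷ ↑ α ∷ R γ ∷ B ∷ []                ≈⟨ at 2 (B-shift α) ⟩
    ↑ α ∷ R γ ∷ ↑ ↑ α ∷ B ∷ R γ ∷ B ∷ []              ≈⟨ at 1 (R-shift γ (↑ α)) ⟩
    ↑ α ∷ ↑ ↑ α ∷ R γ ∷ B ∷ R γ ∷ B ∷ []              ≈⟨ at 3 (R-↑ γ) ⟨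
    ↑ α ∷ ↑ ↑ α ∷ R γ ∷ R (↑ γ) ∷ B ∷ B ∷ []          ≈⟨ at 2 (R-∘ (↑ γ) γ) ⟨
    ↑ α ∷ ↑ ↑ α ∷ R (↑ γ ∘ γ) ∷ B ∷ B ∷ []            ∎

  -- The positive crossing sits on the side of the nested units. `α-α-C` drags it around to the side
  -- of the `γ`s, where it meets the negative one and `C-γ-γ` absorbs both.
  Tr-Tr-C : Tr ∷ Tr ∷ R (C neg) ∷ ↑ C pos ∷ [] ≈ Tr ∷ Tr ∷ []
  Tr-Tr-C = begin
    Tr ∷ Tr ∷ R (C neg) ∷ ↑ C pos ∷ []
      ≈⟨ at 0 Tr-Tr ⟩
    ↑ α ∷ ↑ ↑ α ∷ R (↑ γ ∘ γ) ∷ B ∷ B ∷ R (C neg) ∷ ↑ C pos ∷ []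
      ≈⟨ at 4 (R-↑ (C neg)) ⟨
    ↑ α ∷ ↑ ↑ α ∷ R (↑ γ ∘ γ) ∷ B ∷ R (↑ C neg) ∷ B ∷ ↑ C pos ∷ []
      ≈⟨ at 3 (R-↑ (↑ C neg)) ⟨
    ↑ α ∷ ↑ ↑ α ∷ R (↑ γ ∘ γ) ∷ R (↑ ↑ C neg) ∷ B ∷ B ∷ ↑ C pos ∷ []
      ≈⟨ under 5 (B-shift (C pos)) ⟩
    ↑ α ∷ ↑ ↑ α ∷ R (↑ γ ∘ γ) ∷ R (↑ ↑ C neg) ∷ B ∷ ↑ ↑ C pos ∷ B ∷ []
      ≈⟨ at 4 (B-shift (↑ C pos)) ⟩
    ↑ α ∷ ↑ ↑ α ∷ R (↑ γ ∘ γ) ∷ R (↑ ↑ C neg) ∷ ↑ ↑ ↑ C pos ∷ B ∷ B ∷ []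
      ≈⟨ at 3 (R-shift (↑ ↑ C neg) (↑ ↑ C pos)) ⟩
    ↑ α ∷ ↑ ↑ α ∷ R (↑ γ ∘ γ) ∷ ↑ ↑ ↑ C pos ∷ R (↑ ↑ C neg) ∷ B ∷ B ∷ []
      ≈⟨ at 2 (R-shift (↑ γ ∘ γ) (↑ ↑ C pos)) ⟩
    ↑ α ∷ ↑ ↑ α ∷ ↑ ↑ ↑ C pos ∷ R (↑ γ ∘ γ) ∷ R (↑ ↑ C neg) ∷ B ∷ B ∷ []
      ≈⟨ at 0 (shift (α-α-C pos)) ⟩
    ↑ α ∷ ↑ ↑ α ∷ ↑ C pos ∷ R (↑ γ ∘ γ) ∷ R (↑ ↑ C neg) ∷ B ∷ B ∷ []
      ≈⟨ at 2 (R-shift (↑ γ ∘ γ) (C pos)) ⟨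
    ↑ α ∷ ↑ ↑ α ∷ R (↑ γ ∘ γ) ∷ ↑ C pos ∷ R (↑ ↑ C neg) ∷ B ∷ B ∷ []
      ≈⟨ at 3 (R-shift (↑ ↑ C neg) (C pos)) ⟨
    ↑ α ∷ ↑ ↑ α ∷ R (↑ γ ∘ γ) ∷ R (↑ ↑ C neg) ∷ ↑ C pos ∷ B ∷ B ∷ []
      ≈⟨ under 4 (C-arrow pos) ⟨
    ↑ α ∷ ↑ ↑ α ∷ R (↑ γ ∘ γ) ∷ R (↑ ↑ C neg) ∷ R (C pos) ∷ B ∷ B ∷ []
      ≈⟨ at 2 (R-∘ (↑ ↑ C neg) (↑ γ ∘ γ)) ⟨
    ↑ α ∷ ↑ ↑ α ∷ R (↑ ↑ C neg ∘ (↑ γ ∘ γ)) ∷ R (C pos) ∷ B ∷ B ∷ []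
      ≈⟨ at 2 (R-∘ (C pos) (↑ ↑ C neg ∘ (↑ γ ∘ γ))) ⟨
    ↑ α ∷ ↑ ↑ α ∷ R (C pos ∘ (↑ ↑ C neg ∘ (↑ γ ∘ γ))) ∷ B ∷ B ∷ []
      ≈⟨ at 2 (letter (cong R (equal (C-γ-γ pos)))) ⟩
    ↑ α ∷ ↑ ↑ α ∷ R (↑ γ ∘ γ) ∷ B ∷ B ∷ []
      ≈⟨ Tr-Tr ⟨
    Tr ∷ Tr ∷ [] ∎

  trace : IsTrace θ Tr
  trace =
      (λ t → equal (begin
        C t · B · Tr ∷ B ∷ []           ≈⟨ at 0 (letter (R-def t Tr)) ⟩
        R Tr ∷ B ∷ []                   ≈⟨ Tr-arrow ⟩
        ↑ Tr ∷ B ∷ B ∷ []               ≈⟨ under 1 (by (cong (B ∘_) (∘-identityʳ B))) ⟨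
        ↑ Tr ∷ B ^ 2 ∷ []               ∎))
    , (λ t → equal (begin
        ↑ Tr ∷ C t · B · B ∷ B ∷ []     ≈⟨ at 1 (letter (R-def t B)) ⟩
        ↑ Tr ∷ R B ∷ B ∷ []             ≈⟨ B-Tr ⟩
        B ∷ Tr ∷ []                     ∎))
    , Tr-C
    , (λ t → equal (begin
        Tr ^ 2 ∷ (C t · B · C neg) ∘ ↑ C pos ∷ []        ≈⟨ at 0 Tr² ⟩
        Tr ∷ Tr ∷ (C t · B · C neg) ∘ ↑ C pos ∷ []       ≈⟨ under 2 (fuse (C t · B · C neg ∷ ↑ C pos ∷ [])) ⟩
        Tr ∷ Tr ∷ C t · B · C neg ∷ ↑ C pos ∷ []         ≈⟨ at 2 (letter (R-def t (C neg))) ⟩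
        Tr ∷ Tr ∷ R (C neg) ∷ ↑ C pos ∷ []               ≈⟨ Tr-Tr-C ⟩
        Tr ∷ Tr ∷ []                                     ≈⟨ Tr² ⟨
        Tr ^ 2 ∷ []                                      ∎))
    where
    Tr² : Tr ^ 2 ∷ [] ≈ Tr ∷ Tr ∷ []
    Tr² = by (cong (Tr ∘_) (∘-identityʳ Tr))

theorem5p6 : ∀ {ℓ : Level} (𝒜 : BCI-data ℓ) → BCI-data.IsExtensional 𝒜 →
    (θ : Sign → BCI-data.Carrier 𝒜) → BCI-data.IsBalancing 𝒜 θ →
    (Σ (BCI-data.Carrier 𝒜) (λ Tr → BCI-data.IsTrace 𝒜 θ Tr))
    ⇔ (Σ (BCI-data.Carrier 𝒜) (λ α → Σ (BCI-data.Carrier 𝒜) (λ β → BCI-data.IsRibbon 𝒜 θ α β)))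
theorem5p6 𝒜 ext θ bal = mk⇔
  (λ (Tr , trace) → let open Traced 𝒜 ext θ bal Tr trace in α , β pos , ribbon)
  (λ (α , β , rib) → let open Ribbon 𝒜 ext θ bal α β rib in Tr , trace)
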